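{- Let $q$ be a prime power and let $L$ be a line of $\mathrm{PG}(5,q)$ in the $K$-orbit $o_6$. Then the hyperplane-orbit distribution of $L$ is $OD_4(L)=\left[q+1,\,\frac{3q^2+q}{2},\,\frac{q^2-q}{2},\,q^3-q^2\right]$.
   Context: A point $(y_0,\dots,y_5)$ of $\mathrm{PG}(5,q)$ is identified with the nonzero symmetric matrix $\begin{bmatrix} y_0&y_1&y_2\\ y_1&y_3&y_4\\ y_2&y_4&y_5\end{bmatrix}$ up to scalar. $K\cong\mathrm{PGL}(3,q)$ acts by $M\mapsto AMA^T$, $A\in\mathrm{GL}(3,q)$. The orbit $o_6$ is the $K$-orbit of the line $\left\{\begin{bmatrix} x&y&0\\ y&0&0\\ 0&0&0\end{bmatrix}:(x,y)\in\mathrm{PG}(1,q)\right\}$. Hyperplanes correspond to conics of $\mathrm{PG}(2,q)$ (nonzero quadratic forms up to scalar): $\sum_{0\le i\le j\le2}a_{ij}X_iX_j$ corresponds to $a_{00}Y_0+a_{01}Y_1+a_{02}Y_2+a_{11}Y_3+a_{12}Y_4+a_{22}Y_5=0$. $\mathcal H_1,\mathcal H_{2,r},\mathcal H_{2,i},\mathcal H_3$ are the sets of hyperplanes corresponding respectively to double lines (scalar multiples of squares of linear forms), pairs of distinct real lines (products of two non-proportional linear forms over $\mathbb F_q$), pairs of conjugate imaginary lines (scalar multiples of products of two non-proportional linear forms conjugate over $\mathbb F_{q^2}$), and non-singular conics (those with $4a_{00}a_{11}a_{22}+a_{01}a_{02}a_{12}-a_{00}a_{12}^2-a_{11}a_{02}^2-a_{22}a_{01}^2\ne0$).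 $OD_4(L)=[h_1,h_{2,r},h_{2,i},h_3]$ lists the numbers of hyperplanes in $\mathcal H_1,\mathcal H_{2,r},\mathcal H_{2,i},\mathcal H_3$ containing $L$. -}

module Defs where

open import Algebra.Bundles using (CommutativeRing; RawRing)
open import Algebra.Morphism.Structures using (IsRingHomomorphism)
import Algebra.Definitions.RawSemiring as RawSemiringDefinitions
open import Algebra.Structures using (IsCommutativeRing)
open import Data.Fin.Base using (Fin)
open import Data.Nat.Base as ℕ using (ℕ; suc)
open import Data.Nat.Primality using (Prime)
open import Data.Product.Base using (Σ; ∃; ∃₂; _×_; _,_; proj₁; proj₂)
open import Data.Vec.Base using (Vec; []; _∷_; map; zipWith; foldr′; replicate; transpose)
open import Data.Vec.Properties using (map-id; map-cong; map-∘; ∷-injectiveˡ; ∷-injectiveʳ)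
open import Function.Bundles using (_↔_; _⇔_; Inverse)
open import Level using (0ℓ)
open import Relation.Binary.Bundles using (Setoid)
import Relation.Binary.Construct.On as On
open import Relation.Binary.PropositionalEquality
  using (_≡_; _≢_; refl; sym; trans; cong; module ≡-Reasoning)
  renaming (setoid to ≡-setoid)
open import Relation.Nullary.Negation using (¬_)

IsPrimePower : ℕ → Set
IsPrimePower q = ∃₂ λ p k → Prime p × 1 ℕ.≤ k × q ≡ p ℕ.^ k

record FiniteField (q : ℕ) : Set₁ where
  infixl 6 _+_
  infixl 7 _*_
  infix  8 -_
  field
    Carrier           : Set
    _+_ _*_           : Carrier → Carrier → Carrier
    -_                : Carrier → Carrier
    0# 1#             : Carrier
    isCommutativeRing : IsCommutativeRing _≡_ _+_ _*_ -_ 0# 1#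
    1≢0               : 1# ≢ 0#
    inverse           : ∀ x → x ≢ 0# → ∃ λ y → x * y ≡ 1#
    enumeration       : Carrier ↔ Fin q

  commutativeRing : CommutativeRing 0ℓ 0ℓ
  commutativeRing = record { isCommutativeRing = isCommutativeRing }

  open CommutativeRing commutativeRing public
    using (_-_; rawRing; *-assoc; *-comm; *-identityˡ; zeroʳ)
  open RawSemiringDefinitions (RawRing.rawSemiring rawRing) public
    using (_^_) renaming (_×_ to _×ᶠ_)

-- The field with q² elements as an extension of a given field with q elements.
-- By uniqueness of finite fields it is determined up to isomorphism.
record QuadraticExtension {q : ℕ} (F : FiniteField q) : Set₁ where
  field
    E                  : FiniteField (q ℕ.^ 2)
    ι                  : FiniteField.Carrier F → FiniteField.Carrier E
    isRingHomomorphism : IsRingHomomorphism (FiniteField.rawRing F) (FiniteField.rawRing E) ι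

  conjugate : FiniteField.Carrier E → FiniteField.Carrier E
  conjugate x = FiniteField._^_ E x q

HasSize : Setoid 0ℓ 0ℓ → ℕ → Set
HasSize S n = Inverse S (≡-setoid (Fin n))

module Projective {q : ℕ} (F : FiniteField q) where
  open FiniteField F

  infixr 7 _·_
  infix  7 _∙_

  _·_ : ∀ {n} → Carrier → Vec Carrier n → Vec Carrier n
  c · v = map (c *_) v

  _⊕_ : ∀ {n} → Vec Carrier n → Vec Carrier n → Vec Carrier n
  _⊕_ = zipWith _+_

  _∙_ : ∀ {n} → Vec Carrier n → Vec Carrier n → Carrier
  v ∙ w = foldr′ _+_ 0# (zipWith _*_ v w)

  𝟎 : ∀ {n} → Vec Carrier n
  𝟎 = replicate _ 0#

  Proportional : ∀ {n} → Vec Carrier n → Vec Carrier n → Set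
  Proportional v w = ∃ λ c → c ≢ 0# × w ≡ c · v

  private
    ·-· : ∀ {n} c d (v : Vec Carrier n) → c · d · v ≡ (c * d) · v
    ·-· c d v = trans (sym (map-∘ _ _ v)) (map-cong (λ x → sym (*-assoc c d x)) v)

    1· : ∀ {n} (v : Vec Carrier n) → 1# · v ≡ v
    1· v = trans (map-cong *-identityˡ v) (map-id v)

    unit≢0 : ∀ {c d} → c * d ≡ 1# → d ≢ 0#
    unit≢0 {c} cd≡1 refl = 1≢0 (trans (sym cd≡1) (zeroʳ c))

    Proportional-refl : ∀ {n} {v : Vec Carrier n} → Proportional v v
    Proportional-refl {v = v} = 1# , 1≢0 , sym (1· v)

    Proportional-sym : ∀ {n} {v w : Vec Carrier n} → Proportional v w → Proportional w v
    Proportional-sym {v = v} (c , c≢0 , refl) with inverse c c≢0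
    ... | d , cd≡1 = d , unit≢0 cd≡1 ,
      sym (trans (·-· d c v) (trans (cong (_· v) (trans (*-comm d c) cd≡1)) (1· v)))

    Proportional-trans : ∀ {n} {u v w : Vec Carrier n} →
                         Proportional u v → Proportional v w → Proportional u w
    Proportional-trans {u = u} (c , c≢0 , refl) (d , d≢0 , refl) = d * c , dc≢0 , ·-· d c u
      where
      dc≢0 : d * c ≢ 0#
      dc≢0 dc≡0 with inverse d d≢0
      ... | e , de≡1 = c≢0 (begin
        c            ≡⟨ *-identityˡ c ⟨
        1# * c       ≡⟨ cong (_* c) (trans (*-comm e d) de≡1) ⟨
        (e * d) * c  ≡⟨ *-assoc e d c ⟩
        e * (d * c)  ≡⟨ cong (e *_) dc≡0 ⟩
        e * 0#       ≡⟨ zeroʳ e ⟩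
        0#           ∎)
        where open ≡-Reasoning

  Point : ℕ → Set
  Point n = Σ (Vec Carrier (suc n)) (_≢ 𝟎)

  PG : ℕ → Setoid 0ℓ 0ℓ
  PG n = record
    { Carrier       = Point n
    ; _≈_           = λ P Q → Proportional (proj₁ P) (proj₁ Q)
    ; isEquivalence = record
      { refl  = Proportional-refl
      ; sym   = Proportional-sym
      ; trans = Proportional-trans
      }
    }

  record Line (n : ℕ) : Set where
    constructor line
    field
      P Q      : Point n
      distinct : ¬ Proportional (proj₁ P) (proj₁ Q)

  _∈ˡ_ : ∀ {n} → Point n → Line n → Set
  R ∈ˡ L = ∃₂ λ x y → proj₁ R ≡ (x · proj₁ P) ⊕ (y · proj₁ Q)
    where open Line L

  Matrix : Set
  Matrix = Vec (Vec Carrier 3) 3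

  _⊗_ : Matrix → Matrix → Matrix
  A ⊗ B = map (λ row → map (row ∙_) (transpose B)) A

  𝟏 : Matrix
  𝟏 = (1# ∷ 0# ∷ 0# ∷ [])
    ∷ (0# ∷ 1# ∷ 0# ∷ [])
    ∷ (0# ∷ 0# ∷ 1# ∷ []) ∷ []

  GL₃ : Set
  GL₃ = Σ Matrix λ A → ∃ λ B → A ⊗ B ≡ 𝟏 × B ⊗ A ≡ 𝟏

  toMatrix : Vec Carrier 6 → Matrix
  toMatrix (y₀ ∷ y₁ ∷ y₂ ∷ y₃ ∷ y₄ ∷ y₅ ∷ []) =
      (y₀ ∷ y₁ ∷ y₂ ∷ [])
    ∷ (y₁ ∷ y₃ ∷ y₄ ∷ [])
    ∷ (y₂ ∷ y₄ ∷ y₅ ∷ []) ∷ []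

  -- L′ is the image of L under some M ↦ A M Aᵀ.  Every nonzero multiple of a
  -- representative of a point of L again represents a point of L, so the
  -- matrix equation need not mention a scalar.
  SameKOrbit : Line 5 → Line 5 → Set
  SameKOrbit L L′ = Σ GL₃ λ (A , _) → ∀ S →
    S ∈ˡ L′ ⇔ (∃ λ R → R ∈ˡ L × toMatrix (proj₁ S) ≡ (A ⊗ toMatrix (proj₁ R)) ⊗ transpose A)

  o₆-representative : Line 5
  o₆-representative = line
    (1# ∷ 0# ∷ 0# ∷ 0# ∷ 0# ∷ 0# ∷ [] , λ eq → 1≢0 (∷-injectiveˡ eq))
    (0# ∷ 1# ∷ 0# ∷ 0# ∷ 0# ∷ 0# ∷ [] , λ eq → 1≢0 (∷-injectiveˡ (∷-injectiveʳ eq)))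
    (λ (c , _ , eq) → 1≢0 (trans (∷-injectiveˡ (∷-injectiveʳ eq)) (zeroʳ c)))

  o₆ : Line 5 → Set
  o₆ L = SameKOrbit o₆-representative L

  -- A hyperplane of PG(5,q), and equally the corresponding conic, is given by
  -- the coefficients (a₀₀, a₀₁, a₀₂, a₁₁, a₁₂, a₂₂) up to a scalar.
  QuadraticForm : Set
  QuadraticForm = Vec Carrier 6

  LinearForm : Set
  LinearForm = Vec Carrier 3

  infixl 7 _⊛_
  _⊛_ : LinearForm → LinearForm → QuadraticForm
  (a₀ ∷ a₁ ∷ a₂ ∷ []) ⊛ (b₀ ∷ b₁ ∷ b₂ ∷ []) =
      a₀ * b₀ ∷ a₀ * b₁ + a₁ * b₀ ∷ a₀ * b₂ + a₂ * b₀
    ∷ a₁ * b₁ ∷ a₁ * b₂ + a₂ * b₁ ∷ a₂ * b₂ ∷ []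

  Contains : QuadraticForm → Line 5 → Set
  Contains a L = ∀ R → R ∈ˡ L → a ∙ proj₁ R ≡ 0#

  discriminant : QuadraticForm → Carrier
  discriminant (a₀₀ ∷ a₀₁ ∷ a₀₂ ∷ a₁₁ ∷ a₁₂ ∷ a₂₂ ∷ []) =
    4 ×ᶠ (a₀₀ * a₁₁ * a₂₂) + a₀₁ * a₀₂ * a₁₂
      - a₀₀ * a₁₂ ^ 2 - a₁₁ * a₀₂ ^ 2 - a₂₂ * a₀₁ ^ 2

module HyperplaneOrbits {q : ℕ} {F : FiniteField q} (E∕F : QuadraticExtension F) where
  open FiniteField F using (Carrier; 0#)
  open QuadraticExtension E∕F
  open Projective F
  module PE = Projective E

  𝓗₁ 𝓗₂,ᵣ 𝓗₂,ᵢ 𝓗₃ : QuadraticForm → Set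

  𝓗₁ a = ∃₂ λ c ℓ → a ≡ c · (ℓ ⊛ ℓ)

  𝓗₂,ᵣ a = ∃₂ λ ℓ m → ¬ Proportional ℓ m × a ≡ ℓ ⊛ m

  𝓗₂,ᵢ a = ∃₂ λ (c : Carrier) (ℓ : PE.LinearForm) →
    ¬ PE.Proportional ℓ (map conjugate ℓ) ×
    map ι a ≡ ι c PE.· (ℓ PE.⊛ map conjugate ℓ)

  𝓗₃ a = discriminant a ≢ 0#

  HyperplanesThrough : Line 5 → (QuadraticForm → Set) → Setoid 0ℓ 0ℓ
  HyperplanesThrough L 𝓗 = On.setoid (PG 5)
    (proj₁ {B = λ h → Contains (proj₁ h) L × 𝓗 (proj₁ h)})

  OD₄[_]≡ : Line 5 → Vec ℕ 4 → Set
  OD₄[ L ]≡ (h₁ ∷ h₂,ᵣ ∷ h₂,ᵢ ∷ h₃ ∷ []) =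
      HasSize (HyperplanesThrough L 𝓗₁)   h₁
    × HasSize (HyperplanesThrough L 𝓗₂,ᵣ) h₂,ᵣ
    × HasSize (HyperplanesThrough L 𝓗₂,ᵢ) h₂,ᵢ
    × HasSize (HyperplanesThrough L 𝓗₃)   h₃

{-# OPTIONS --safe #-}

-- Substituting an invertible A turns the hyperplanes through the image of a
-- line into those through the line itself and preserves the four orbits (for 𝓗₃
-- because the discriminant is multiplied by the nonzero square of det A), so
-- only the representative matters.  The hyperplanes containing it are the
-- conics with a₀₀ = a₀₁ = 0, whose discriminant is −a₁₁a₀₂².  If a₀₂ = 0, such
-- a conic is a binary form in X₁, X₂, and factors over 𝔽_q or 𝔽_q² uniquely up
-- to order: the squares are counted by the points of PG(1,q), the real pairs by
-- the unordered pairs of points, the imaginary pairs by the orbits of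
-- conjugation on 𝔽_q² ∖ 𝔽_q.  The remaining singular conics are X₂(X₀ + sX₁ + tX₂).
--
-- That conjugation x ↦ x^q is additive with fixed field 𝔽_q follows from
-- x^q − x = ∏ (x − c), c ∈ 𝔽_q: the right side is visibly invariant under
-- x ↦ x + 1, hence (x + 1)^q = x^q + 1, and homogeneity does the rest.
module Submission where

open import Defs
open import Algebra.Bundles using (CommutativeRing; RawRing)
import Algebra.Definitions.RawSemiring as RawSemiringDefinitions
open import Algebra.Morphism.Structures using (IsRingHomomorphism)
import Algebra.Properties.CommutativeMonoid.Sum as Sums
import Algebra.Properties.CommutativeSemiring.Exp as CommutativeExp
import Algebra.Properties.Ring as RingProperties
import Algebra.Properties.Semiring.Exp as Exp
open import Data.Bool.Base using (Bool; true; false; not; T)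
open import Data.Bool.Properties using (T-irrelevant)
open import Data.Empty using (⊥)
open import Data.Fin.Base as Fin using (Fin; zero; suc; toℕ)
open import Data.Fin.Patterns using (0F; 1F; 2F; 3F; 4F; 5F)
open import Data.Fin.Permutation using (↔⇒≡)
open import Data.Fin.Properties using (+↔⊎; *↔×; 1↔⊤; <-cmp; _<?_; <-asym; suc-injective)
  renaming (_≟_ to _≟ᶠ_)
open import Data.Integer.Base as ℤ using (ℤ; 0ℤ; 1ℤ)
import Data.Integer.Properties as ℤₚ
open import Data.Maybe.Base using (nothing)
open import Data.Nat.Base as ℕ using (ℕ; zero; suc; _∸_)
open import Data.Nat.Divisibility using (n∣m*n)
open import Data.Nat.DivMod using (_/_; _mod_; m*n/n≡m; +-distrib-/-∣ˡ)
open import Data.Nat.Properties using (m+n∸m≡n; m+n∸n≡m; *-distribʳ-∸)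
  renaming (*-comm to ℕ-*-comm; +-identityʳ to ℕ-+-identityʳ; *-identityʳ to ℕ-*-identityʳ)
open import Data.Nat.Tactic.RingSolver using (solve-∀)
open import Data.Product.Base using (Σ; ∃; _×_; _,_; proj₁; proj₂)
open import Data.Product.Function.Dependent.Propositional using (Σ-↔)
open import Data.Product.Function.NonDependent.Propositional using (_×-↔_)
open import Data.Product.Properties using (,-injectiveˡ)
open import Data.Sum.Base as Sum using (_⊎_; inj₁; inj₂)
open import Data.Sum.Function.Propositional using (_⊎-↔_)
open import Data.Sum.Properties using (inj₁-injective)
open import Data.Unit.Base using (⊤; tt)
open import Data.Vec.Base as Vec
  using (Vec; []; _∷_; _++_; concat; foldr′; lookup; map; replicate; tabulate; transpose; zipWith)
open import Data.Vec.Properties using (≡-dec; lookup-map; map-∘; map-cong)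
open import Function.Base using (_∘_; const)
open import Function.Bundles using (_↔_; Equivalence; Injection; Inverse; mk↔ₛ′)
open import Function.Construct.Composition using (_↔-∘_) renaming (inverse to ∘-inverse)
open import Function.Construct.Identity using (↔-id)
open import Function.Construct.Symmetry using (↔-sym)
open import Function.Properties.Inverse using (↔⇒↣)
open import Level using (0ℓ)
open import Relation.Binary.Bundles using (Setoid)
open import Relation.Binary.Definitions using (DecidableEquality; tri<; tri≈; tri>)
open import Relation.Binary.PropositionalEquality
  using (_≡_; _≢_; refl; sym; trans; cong; cong₂; subst; module ≡-Reasoning)
open import Relation.Nullary.Decidable
  using (Dec; yes; no; False; True; fromWitness; fromWitnessFalse; toWitness; toWitnessFalse; via-injection)
open import Relation.Nullary.Negation using (¬_; contradiction)
open import Relation.Unary using (Decidable)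
import Tactic.RingSolver.Core.AlmostCommutativeRing as ACR
open import Tactic.RingSolver.Core.Expression using ()
  renaming (Κ to con; _⊕_ to _:+_; _⊗_ to _:*_; ⊝_ to :-_)
import Tactic.RingSolver.Core.Expression as Expression
open import Tactic.RingSolver.Core.Polynomial.Parameters using (Homomorphism)

-- Each of the four sets is a setoid of witnessed forms modulo scalars, so a count amounts to a
-- family of normal forms that meets every class exactly once. Scaling is fixed by making a suitable
-- coefficient 1. The ambiguity that remains, the order of two lines or the choice between β and its
-- conjugate, is a fixed-point-free involution on the parameters; it is removed by keeping the
-- element that comes first in the enumeration.
--
-- The argument is uniform in the characteristic. Completing squares and halving are avoided: binary
-- forms are compared through their zeros, substitution is expressed by polarisation, and the
-- polynomial identities hold over ℤ, where the ring solver verifies them.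
--
-- Membership in `𝓗₂,ᵢ` is a statement over 𝔽_q² about a form over 𝔽_q, and conjugation links the
-- two fields. It has to be a ring homomorphism for substitution to keep conjugate factors
-- conjugate, and its fixed field has to be 𝔽_q for the coefficients of (X₁ + βX₂)(X₁ + β̄X₂), the
-- trace and the norm of β, to descend.

-- Finite types: sizes of subsets, complements and orbit sets of involutions.

module FiniteTypes where

  private variable
    X Y : Set
    m n : ℕ

  -- `surjective` picks a normal form for each element, and `injective` makes this choice
  -- independent of the representative of the class.
  HasSize-via : (S : Setoid 0ℓ 0ℓ) → X ↔ Fin n → (f : X → Setoid.Carrier S) →
                (∀ {x y} → Setoid._≈_ S (f x) (f y) → x ≡ y) →
                (∀ s → ∃ λ x → Setoid._≈_ S (f x) s) → HasSize S n
  HasSize-via S X↔n f injective surjective = record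
    { to        = λ s → to (preimage s)
    ; from      = λ i → f (from i)
    ; to-cong   = λ {s} {t} s≈t → cong to (injective
                    (S.trans (image s) (S.trans s≈t (S.sym (image t)))))
    ; from-cong = λ { refl → S.refl }
    ; inverse   =
        (λ {i} {s} s≈fi → trans (cong to (injective (S.trans (image s) s≈fi))) (strictlyInverseˡ i))
      , (λ {s} {i} i≡ → S.trans
          (S.reflexive (cong f (trans (cong from i≡) (strictlyInverseʳ _)))) (image s))
    }
    where
    module S = Setoid S
    open Inverse X↔n
    preimage : S.Carrier → _
    preimage s = proj₁ (surjective s)
    image : ∀ s → f (preimage s) S.≈ s
    image s = proj₂ (surjective s)

  -- Subsets are cut out by Boolean tests because proofs of `T` are unique: no element is counted
  -- once per membership proof.
  T-Σ-≡ : {b : X → Bool} {u v : Σ X (T ∘ b)} → proj₁ u ≡ proj₁ v → u ≡ v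
  T-Σ-≡ {u = x , p} {v = .x , q} refl = cong (x ,_) (T-irrelevant p q)

  abstract
    Fin-filter-size : (b : Fin n → Bool) → ∃ λ m → Σ (Fin n) (T ∘ b) ↔ Fin m
    Fin-filter-size {zero}  b = 0 , mk↔ₛ′ proj₁ (λ ()) (λ ()) (λ ())
    Fin-filter-size {suc n} b with b zero in eq | Fin-filter-size (b ∘ suc)
    ... | false | m , I = m , I ↔-∘ mk↔ₛ′ f (λ (i , p) → suc i , p) (λ _ → refl) g
      where
      f : Σ (Fin (suc n)) (T ∘ b) → Σ (Fin n) (T ∘ b ∘ suc)
      f (zero  , p) = contradiction (subst T eq p) (λ ())
      f (suc i , p) = i , p
      g : ∀ u → (suc (proj₁ (f u)) , proj₂ (f u)) ≡ u
      g (zero  , p) = contradiction (subst T eq p) (λ ())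
      g (suc i , p) = refl
    ... | true  | m , I = suc m , (↔-sym (+↔⊎ {1}) ↔-∘ (↔-sym 1↔⊤ ⊎-↔ I)) ↔-∘ mk↔ₛ′ f g fg gf
      where
      f : Σ (Fin (suc n)) (T ∘ b) → ⊤ ⊎ Σ (Fin n) (T ∘ b ∘ suc)
      f (zero  , p) = inj₁ tt
      f (suc i , p) = inj₂ (i , p)
      g : ⊤ ⊎ Σ (Fin n) (T ∘ b ∘ suc) → Σ (Fin (suc n)) (T ∘ b)
      g (inj₁ _)       = zero , subst T (sym eq) tt
      g (inj₂ (i , p)) = suc i , p
      fg : ∀ s → f (g s) ≡ s
      fg (inj₁ _) = refl
      fg (inj₂ _) = refl
      gf : ∀ u → g (f u) ≡ u
      gf (zero  , p) = T-Σ-≡ refl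
      gf (suc i , p) = refl

    filter-size : X ↔ Fin n → (b : X → Bool) → ∃ λ m → Σ X (T ∘ b) ↔ Fin m
    filter-size X↔n b with Fin-filter-size (b ∘ Inverse.from X↔n)
    ... | m , I = m , I ↔-∘ ↔-sym (Σ-↔ (↔-sym X↔n) (↔-id _))

  T⊎T-not : ∀ x → T x ⊎ T (not x)
  T⊎T-not true  = inj₁ tt
  T⊎T-not false = inj₂ tt

  T-not : ∀ x → T x → ¬ T (not x)
  T-not true _ ()

  split : (b : X → Bool) → X ↔ (Σ X (T ∘ b) ⊎ Σ X (T ∘ not ∘ b))
  split {X} b = mk↔ₛ′ f g fg gf
    where
    f : X → Σ X (T ∘ b) ⊎ Σ X (T ∘ not ∘ b)
    f x = Sum.map (x ,_) (x ,_) (T⊎T-not (b x))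
    g : Σ X (T ∘ b) ⊎ Σ X (T ∘ not ∘ b) → X
    g = Sum.[ proj₁ , proj₁ ]
    fg : ∀ s → f (g s) ≡ s
    fg (inj₁ (x , p)) with T⊎T-not (b x)
    ... | inj₁ _ = cong inj₁ (T-Σ-≡ refl)
    ... | inj₂ q = contradiction q (T-not (b x) p)
    fg (inj₂ (x , p)) with T⊎T-not (b x)
    ... | inj₁ q = contradiction p (T-not (b x) q)
    ... | inj₂ _ = cong inj₂ (T-Σ-≡ refl)
    gf : ∀ x → g (f x) ≡ x
    gf x with T⊎T-not (b x)
    ... | inj₁ _ = refl
    ... | inj₂ _ = refl

  split-size : X ↔ Fin n → (b : X → Bool) → ∀ {m m′} →
               Σ X (T ∘ b) ↔ Fin m → Σ X (T ∘ not ∘ b) ↔ Fin m′ → n ≡ m ℕ.+ m′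
  split-size X↔n b I J = ↔⇒≡ (((↔-sym +↔⊎ ↔-∘ (I ⊎-↔ J)) ↔-∘ split b) ↔-∘ ↔-sym X↔n)

  module _ {P : X → Set} (P? : Decidable P) where

    True-Σ-≡ : {u v : Σ X (True ∘ P?)} → proj₁ u ≡ proj₁ v → u ≡ v
    True-Σ-≡ = T-Σ-≡

    False-Σ-≡ : {u v : Σ X (False ∘ P?)} → proj₁ u ≡ proj₁ v → u ≡ v
    False-Σ-≡ = T-Σ-≡

    abstract
      -- The complement is never listed. Filtering gives it some size m′, the subset has size m
      -- through `f`, and n = m + m′ determines m′.
      complement-size : X ↔ Fin n → Y ↔ Fin m → (f : Y → X) → (∀ {y z} → f y ≡ f z → y ≡ z) →
                        (∀ y → P (f y)) → (∀ {x} → P x → ∃ λ y → f y ≡ x) →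
                        Σ X (False ∘ P?) ↔ Fin (n ∸ m)
      complement-size {n = n} {m = m} X↔n Y↔m f injective Pf P⇒f with filter-size X↔n (not ∘ _)
      ... | m′ , J = subst (λ k → _ ↔ Fin k) (sym n∸m≡m′) J
        where
        I : Σ X (True ∘ P?) ↔ Fin m
        I = Y↔m ↔-∘ mk↔ₛ′
          (λ (x , p) → proj₁ (P⇒f (toWitness p)))
          (λ y → f y , fromWitness (Pf y))
          (λ y → injective (proj₂ (P⇒f (toWitness {a? = P? (f y)} (fromWitness (Pf y))))))
          (λ (x , p) → True-Σ-≡ (proj₂ (P⇒f (toWitness p))))
        n∸m≡m′ : n ∸ m ≡ m′
        n∸m≡m′ = trans (cong (_∸ m) (split-size X↔n _ I J)) (m+n∸m≡n m m′)

  -- Every orbit has exactly two elements, and the enumeration singles out the earlier one without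
  -- any structure on `X`.
  module Involution (X↔n : X ↔ Fin n) (σ : X → X)
                    (σ-involutive : ∀ x → σ (σ x) ≡ x) (σ-fixpoint-free : ∀ x → σ x ≢ x) where
    open Inverse X↔n

    precedes? : Decidable (λ x → to x Fin.< to (σ x))
    precedes? x = to x <? to (σ x)

    Representative : Set
    Representative = Σ X (True ∘ precedes?)

    σ-precedes : ∀ x → ¬ to x Fin.< to (σ x) → to (σ x) Fin.< to (σ (σ x))
    σ-precedes x x≮σx with <-cmp (to x) (to (σ x))
    ... | tri< x<σx _ _ = contradiction x<σx x≮σx
    ... | tri≈ _ x≡σx _ = contradiction
      (trans (sym (strictlyInverseʳ _)) (trans (cong from (sym x≡σx)) (strictlyInverseʳ _)))
      (σ-fixpoint-free x)
    ... | tri> _ _ σx<x = subst (λ y → to (σ x) Fin.< to y) (sym (σ-involutive x)) σx<x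

    σ-not-precedes : ∀ x → to x Fin.< to (σ x) → ¬ to (σ x) Fin.< to (σ (σ x))
    σ-not-precedes x x<σx σx<σσx =
      <-asym x<σx (subst (λ y → to (σ x) Fin.< to y) (σ-involutive x) σx<σσx)

    abstract
      representative : ∀ x → ∃ λ (r : Representative) → x ≡ proj₁ r ⊎ x ≡ σ (proj₁ r)
      representative x with precedes? x in eq
      ... | yes x<σx = (x , fromWitness x<σx) , inj₁ refl
      ... | no  x≮σx = (σ x , fromWitness (σ-precedes x x≮σx)) , inj₂ (sym (σ-involutive x))

      distinct-representatives : ∀ {r s : Representative} →
        proj₁ r ≡ proj₁ s ⊎ proj₁ r ≡ σ (proj₁ s) → r ≡ s
      distinct-representatives (inj₁ eq) = True-Σ-≡ precedes? eq
      distinct-representatives {_ , p} {s , q} (inj₂ refl) =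
        contradiction (toWitness p) (σ-not-precedes s (toWitness q))

      Representative↔ : Representative ↔ Fin (n / 2)
      Representative↔ with filter-size X↔n _
      ... | h , I = subst (λ k → Representative ↔ Fin k) (sym n/2≡h) I
        where
        -- `σ` exchanges the representatives with the remaining elements, so both halves have the
        -- same size h and the division of n = 2h by 2 is exact.
        flip : Σ X (False ∘ precedes?) ↔ Representative
        flip = mk↔ₛ′
          (λ (x , p) → σ x , fromWitness (σ-precedes x (toWitnessFalse p)))
          (λ (x , p) → σ x , fromWitnessFalse (σ-not-precedes x (toWitness p)))
          (λ (x , _) → True-Σ-≡ precedes? (σ-involutive x))
          (λ (x , _) → False-Σ-≡ precedes? (σ-involutive x))
        n/2≡h : n / 2 ≡ h
        n/2≡h = trans (cong (_/ 2) n≡h*2) (m*n/n≡m h 2)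
          where
          n≡h*2 : n ≡ h ℕ.* 2
          n≡h*2 = trans (split-size X↔n _ I (I ↔-∘ flip))
            (trans (cong (h ℕ.+_) (sym (ℕ-+-identityʳ h))) (ℕ-*-comm 2 h))

open FiniteTypes

-- A ring solver with integer coefficients.

module IntegerSolver (R : CommutativeRing 0ℓ 0ℓ) where
  open CommutativeRing R renaming (refl to ≈-refl; sym to ≈-sym; trans to ≈-trans)
  open import Algebra.Properties.Ring ring
    using (-‿involutive; -0#≈0#; -‿distribˡ-*; -‿distribʳ-*; -‿+-comm)
  open import Algebra.Properties.Semiring.Mult.TCOptimised semiring
    using (1+×; ×-homo-+; ×1-homo-*) renaming (_×_ to _×ᴿ_)
  open import Relation.Binary.Reasoning.Setoid setoid

  -- The canonical homomorphism from ℤ. Coefficients are integers because zero is recognised there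
  -- by computation, so that normal forms cancel and compare by `refl`; the elements of `R` are
  -- opaque.
  ⟦_⟧ᶻ : ℤ → Carrier
  ⟦ ℤ.+ n      ⟧ᶻ = n ×ᴿ 1#
  ⟦ ℤ.-[1+ n ] ⟧ᶻ = - (suc n ×ᴿ 1#)

  neg-homo : ∀ i → ⟦ ℤ.- i ⟧ᶻ ≈ - ⟦ i ⟧ᶻ
  neg-homo ℤ.+0       = ≈-sym -0#≈0#
  neg-homo ℤ.+[1+ n ] = ≈-refl
  neg-homo ℤ.-[1+ n ] = ≈-sym (-‿involutive _)

  ⊖-homo : ∀ m n → ⟦ m ℤ.⊖ n ⟧ᶻ ≈ m ×ᴿ 1# - n ×ᴿ 1#
  ⊖-homo m       zero    = begin
    m ×ᴿ 1#       ≈⟨ +-identityʳ _ ⟨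
    m ×ᴿ 1# + 0#  ≈⟨ +-congˡ -0#≈0# ⟨
    m ×ᴿ 1# - 0#  ∎
  ⊖-homo zero    (suc n) = ≈-sym (+-identityˡ _)
  ⊖-homo (suc m) (suc n) = begin
    ⟦ suc m ℤ.⊖ suc n ⟧ᶻ         ≡⟨ cong ⟦_⟧ᶻ (ℤₚ.[1+m]⊖[1+n]≡m⊖n m n) ⟩
    ⟦ m ℤ.⊖ n ⟧ᶻ                 ≈⟨ ⊖-homo m n ⟩
    a - b                        ≈⟨ +-congʳ (+-identityˡ a) ⟨
    0# + a - b                   ≈⟨ +-congʳ (+-congʳ (-‿inverseʳ 1#)) ⟨
    1# - 1# + a - b              ≈⟨ +-congʳ (+-assoc _ _ _) ⟩
    1# + (- 1# + a) - b          ≈⟨ +-congʳ (+-congˡ (+-comm _ _)) ⟩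
    1# + (a - 1#) - b            ≈⟨ +-congʳ (+-assoc _ _ _) ⟨
    1# + a - 1# - b              ≈⟨ +-assoc _ _ _ ⟩
    1# + a + (- 1# - b)          ≈⟨ +-congˡ (-‿+-comm 1# b) ⟩
    1# + a - (1# + b)            ≈⟨ +-cong (1+× m 1#) (-‿cong (1+× n 1#)) ⟨
    suc m ×ᴿ 1# - suc n ×ᴿ 1#    ∎
    where
    a = m ×ᴿ 1#
    b = n ×ᴿ 1#

  add-homo : ∀ i j → ⟦ i ℤ.+ j ⟧ᶻ ≈ ⟦ i ⟧ᶻ + ⟦ j ⟧ᶻ
  add-homo (ℤ.+ m)      (ℤ.+ n)      = ×-homo-+ 1# m n
  add-homo (ℤ.+ m)      ℤ.-[1+ n ]   = ⊖-homo m (suc n)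
  add-homo ℤ.-[1+ m ]   (ℤ.+ n)      = ≈-trans (⊖-homo n (suc m)) (+-comm _ _)
  add-homo ℤ.-[1+ m ]   ℤ.-[1+ n ]   = begin
    ⟦ ℤ.-[1+ m ] ℤ.+ ℤ.-[1+ n ] ⟧ᶻ           ≡⟨ cong ⟦_⟧ᶻ (ℤₚ.neg-distrib-+ (ℤ.+ suc m) (ℤ.+ suc n)) ⟨
    - ((suc m ℕ.+ suc n) ×ᴿ 1#)  ≈⟨ -‿cong (×-homo-+ 1# (suc m) (suc n)) ⟩
    - (suc m ×ᴿ 1# + suc n ×ᴿ 1#)            ≈⟨ -‿+-comm _ _ ⟨
    - (suc m ×ᴿ 1#) - suc n ×ᴿ 1#            ∎

  pos-mul-homo : ∀ i n → ⟦ i ℤ.* (ℤ.+ n) ⟧ᶻ ≈ ⟦ i ⟧ᶻ * (n ×ᴿ 1#)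
  pos-mul-homo (ℤ.+ m)    n = begin
    ⟦ ℤ.+ m ℤ.* ℤ.+ n ⟧ᶻ         ≡⟨ cong ⟦_⟧ᶻ (ℤₚ.pos-* m n) ⟨
    (m ℕ.* n) ×ᴿ 1#  ≈⟨ ×1-homo-* m n ⟩
    m ×ᴿ 1# * (n ×ᴿ 1#)          ∎
  pos-mul-homo ℤ.-[1+ m ] n = begin
    ⟦ ℤ.-[1+ m ] ℤ.* ℤ.+ n ⟧ᶻ         ≡⟨ cong ⟦_⟧ᶻ (ℤₚ.neg-distribˡ-* (ℤ.+ suc m) (ℤ.+ n)) ⟨
    ⟦ ℤ.- (ℤ.+ suc m ℤ.* ℤ.+ n) ⟧ᶻ    ≈⟨ neg-homo (ℤ.+ suc m ℤ.* ℤ.+ n) ⟩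
    - ⟦ ℤ.+ suc m ℤ.* ℤ.+ n ⟧ᶻ        ≈⟨ -‿cong (pos-mul-homo (ℤ.+ suc m) n) ⟩
    - (suc m ×ᴿ 1# * (n ×ᴿ 1#))       ≈⟨ -‿distribˡ-* _ _ ⟩
    - (suc m ×ᴿ 1#) * (n ×ᴿ 1#)       ∎

  mul-homo : ∀ i j → ⟦ i ℤ.* j ⟧ᶻ ≈ ⟦ i ⟧ᶻ * ⟦ j ⟧ᶻ
  mul-homo i (ℤ.+ n)    = pos-mul-homo i n
  mul-homo i ℤ.-[1+ n ] = begin
    ⟦ i ℤ.* ℤ.-[1+ n ] ⟧ᶻ       ≡⟨ cong ⟦_⟧ᶻ (ℤₚ.neg-distribʳ-* i (ℤ.+ suc n)) ⟨
    ⟦ ℤ.- (i ℤ.* ℤ.+ suc n) ⟧ᶻ  ≈⟨ neg-homo (i ℤ.* ℤ.+ suc n) ⟩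
    - ⟦ i ℤ.* ℤ.+ suc n ⟧ᶻ      ≈⟨ -‿cong (pos-mul-homo i (suc n)) ⟩
    - (⟦ i ⟧ᶻ * (suc n ×ᴿ 1#))  ≈⟨ -‿distribʳ-* _ _ ⟩
    ⟦ i ⟧ᶻ * - (suc n ×ᴿ 1#)    ∎

  isZero : ℤ → Bool
  isZero ℤ.+0 = true
  isZero _    = false

  homomorphism : Homomorphism 0ℓ 0ℓ 0ℓ 0ℓ
  homomorphism = record
    { from = record { rawRing = ℤ.+-*-rawRing ; isZero = isZero }
    ; to   = ACR.fromCommutativeRing R (λ _ → nothing)
    ; morphism = record
      { ⟦_⟧ = ⟦_⟧ᶻ ; +-homo = add-homo ; *-homo = mul-homo ; -‿homo = neg-homo
      ; 0-homo = ≈-refl ; 1-homo = ≈-refl }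
    ; Zero-C⟶Zero-R = λ { ℤ.+0 _ → ≈-refl }
    }

  open Expression using (Expr; Κ; Ι; _⊕_; _⊗_; ⊝_)
  open Expression.Eval rawRing ⟦_⟧ᶻ public using (⟦_⟧)
  open import Tactic.RingSolver.Core.Polynomial.Base (Homomorphism.from homomorphism)
  open import Tactic.RingSolver.Core.Polynomial.Semantics homomorphism public
    using () renaming (⟦_⟧ to ⟦_⟧ₚ)
  open import Tactic.RingSolver.Core.Polynomial.Homomorphism homomorphism
  open import Algebra.Properties.Semiring.Exp.TCOptimised semiring using (^-congˡ)

  normalise : ∀ {n} → Expr ℤ n → Poly n
  normalise (Κ x)   = κ x
  normalise (Ι x)   = ι x
  normalise (x ⊕ y) = normalise x ⊞ normalise y
  normalise (x ⊗ y) = normalise x ⊠ normalise y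
  normalise (⊝ x)   = ⊟ normalise x
  normalise (x Expression.⊛ i) = normalise x ⊡ i

  correct : ∀ {n} (e : Expr ℤ n) ρ → ⟦ normalise e ⟧ₚ ρ ≈ ⟦ e ⟧ ρ
  correct (Κ x)   ρ = κ-hom x ρ
  correct (Ι x)   ρ = ι-hom x ρ
  correct (x ⊕ y) ρ = ≈-trans (⊞-hom (normalise x) (normalise y) ρ) (+-cong (correct x ρ) (correct y ρ))
  correct (x ⊗ y) ρ = ≈-trans (⊠-hom (normalise x) (normalise y) ρ) (*-cong (correct x ρ) (correct y ρ))
  correct (⊝ x)   ρ = ≈-trans (⊟-hom (normalise x) ρ) (-‿cong (correct x ρ))
  correct (x Expression.⊛ i) ρ = ≈-trans (⊡-hom (normalise x) i ρ) (^-congˡ i (correct x ρ))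

  open import Relation.Binary.Reflection setoid Ι ⟦_⟧ (λ e → ⟦ normalise e ⟧ₚ) correct public
    using (prove; solve; _⊜_)

  Polynomial : ℕ → Set
  Polynomial = Expr ℤ

  polynomials : ℕ → RawRing 0ℓ 0ℓ
  polynomials n = record
    { Carrier = Polynomial n
    ; _≈_ = _≡_
    ; _+_ = _⊕_
    ; _*_ = _⊗_
    ; -_  = ⊝_
    ; 0#  = Κ 0ℤ
    ; 1#  = Κ 1ℤ
    }

  -- 𝕧 m k consists of the variables xₖ, …, xₖ₊ₘ₋₁; an index beyond the last
  -- variable silently wraps around.
  𝕩 : ∀ {n} → ℕ → Polynomial (suc n)
  𝕩 k = Ι (k mod suc _)

  𝕧 : ∀ {n} m → ℕ → Vec (Polynomial (suc n)) m
  𝕧 m k = tabulate (λ i → 𝕩 (k ℕ.+ toℕ i))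

open ≡-Reasoning

↔-injective : ∀ {X Y : Set} (I : X ↔ Y) {x y} → Inverse.to I x ≡ Inverse.to I y → x ≡ y
↔-injective I = Injection.injective (↔⇒↣ I)

-- Finite fields: cancellation, x^n = x, factorisation at given roots.

module FieldProperties {n : ℕ} (K : FiniteField n) where
  open FiniteField K public
  open CommutativeRing commutativeRing public
    using (+-identityˡ; +-identityʳ; +-comm; *-identityʳ; zeroˡ; -‿inverseʳ; ring; semiring;
           commutativeSemiring; *-commutativeMonoid)
  open RingProperties ring public using (x∙y⁻¹≈ε⇒x≈y; -0#≈0#; -‿involutive)
  open Exp semiring public using (^-assocʳ)
  open CommutativeExp commutativeSemiring public using (^-distrib-*)
  open Sums *-commutativeMonoid public using ()
    renaming (sum to product; sum-permute to product-permute; sum-replicate to product-replicate;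
              ∑-distrib-+ to ∏-distrib-*; sum-cong-≗ to product-cong)
  open IntegerSolver commutativeRing using (solve; _⊜_)

  infix 4 _≟_
  _≟_ : DecidableEquality Carrier
  _≟_ = via-injection (↔⇒↣ enumeration) _≟ᶠ_

  *-cancelˡ : ∀ {x y z} → x ≢ 0# → x * y ≡ x * z → y ≡ z
  *-cancelˡ {x} {y} {z} x≢0 xy≡xz with inverse x x≢0
  ... | x⁻¹ , xx⁻¹≡1 = begin
    y              ≡⟨ *-identityˡ y ⟨
    1# * y         ≡⟨ cong (_* y) x⁻¹x≡1 ⟨
    (x⁻¹ * x) * y  ≡⟨ *-assoc x⁻¹ x y ⟩
    x⁻¹ * (x * y)  ≡⟨ cong (x⁻¹ *_) xy≡xz ⟩
    x⁻¹ * (x * z)  ≡⟨ *-assoc x⁻¹ x z ⟨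
    (x⁻¹ * x) * z  ≡⟨ cong (_* z) x⁻¹x≡1 ⟩
    1# * z         ≡⟨ *-identityˡ z ⟩
    z              ∎
    where
    x⁻¹x≡1 : x⁻¹ * x ≡ 1#
    x⁻¹x≡1 = trans (*-comm x⁻¹ x) xx⁻¹≡1

  zero-product : ∀ {x y} → x * y ≡ 0# → x ≡ 0# ⊎ y ≡ 0#
  zero-product {x} xy≡0 with x ≟ 0#
  ... | yes x≡0 = inj₁ x≡0
  ... | no  x≢0 = inj₂ (*-cancelˡ x≢0 (trans xy≡0 (sym (zeroʳ x))))

  *-nonzero : ∀ {x y} → x ≢ 0# → y ≢ 0# → x * y ≢ 0#
  *-nonzero x≢0 y≢0 xy≡0 with zero-product xy≡0
  ... | inj₁ x≡0 = x≢0 x≡0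
  ... | inj₂ y≡0 = y≢0 y≡0

  inverse-nonzero : ∀ {x y} → x * y ≡ 1# → y ≢ 0#
  inverse-nonzero {x} xy≡1 refl = 1≢0 (trans (sym xy≡1) (zeroʳ x))

  x-y≡0⇒x≡y : ∀ {x y} → x - y ≡ 0# → x ≡ y
  x-y≡0⇒x≡y = x∙y⁻¹≈ε⇒x≈y _ _

  x≡y⇒x-y≡0 : ∀ {x y} → x ≡ y → x - y ≡ 0#
  x≡y⇒x-y≡0 refl = -‿inverseʳ _

  cancel-inverse : ∀ {x y} → x * y ≡ 1# → ∀ z → x * (y * z) ≡ z
  cancel-inverse {x} {y} xy≡1 z = trans (sym (*-assoc x y z)) (trans (cong (_* z) xy≡1) (*-identityˡ z))

  -x≡0⇒x≡0 : ∀ {x} → - x ≡ 0# → x ≡ 0#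
  -x≡0⇒x≡0 {x} eq = trans (sym (-‿involutive x)) (trans (cong -_ eq) -0#≈0#)

  product-zero : ∀ {m} (f : Fin m → Carrier) → product f ≡ 0# → ∃ λ i → f i ≡ 0#
  product-zero {zero}  f eq = contradiction eq 1≢0
  product-zero {suc m} f eq with zero-product eq
  ... | inj₁ f0≡0 = zero , f0≡0
  ... | inj₂ rest with product-zero (f ∘ suc) rest
  ...   | i , fi≡0 = suc i , fi≡0

  -- Transported along the enumeration, `σ` permutes the indices of a commutative product.
  product-reindex : ∀ {X : Set} {m} (I : X ↔ Fin m) (σ : X ↔ X) (f : X → Carrier) →
                    product (f ∘ Inverse.from I) ≡ product (f ∘ Inverse.to σ ∘ Inverse.from I)
  product-reindex I σ f = trans
    (product-permute (f ∘ Inverse.from I) ((I ↔-∘ σ) ↔-∘ ↔-sym I))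
    (product-cong (λ i → cong f (Inverse.strictlyInverseʳ I (Inverse.to σ (Inverse.from I i)))))

  NonZero : Set
  NonZero = Σ Carrier (False ∘ (_≟ 0#))

  nonZero : ∀ {x} → x ≢ 0# → NonZero
  nonZero {x} x≢0 = x , fromWitnessFalse x≢0

  NonZero-≡ : {u v : NonZero} → proj₁ u ≡ proj₁ v → u ≡ v
  NonZero-≡ = False-Σ-≡ (_≟ 0#)

  NonZero↔ : NonZero ↔ Fin (n ∸ 1)
  NonZero↔ = complement-size (_≟ 0#) enumeration (↔-sym 1↔⊤) (λ (_ : ⊤) → 0#)
    (λ _ → refl) (λ _ → refl) (λ x≡0 → tt , sym x≡0)

  scale : ∀ {a} → a ≢ 0# → NonZero ↔ NonZero
  scale {a} a≢0 with inverse a a≢0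
  ... | b , ab≡1 = mk↔ₛ′ (mul a≢0) (mul (inverse-nonzero ab≡1))
    (λ (x , _) → NonZero-≡ (cancel-inverse ab≡1 x))
    (λ (x , _) → NonZero-≡ (cancel-inverse (trans (*-comm b a) ab≡1) x))
    where
    mul : ∀ {c} → c ≢ 0# → NonZero → NonZero
    mul c≢0 (x , x≢0) = nonZero (*-nonzero c≢0 (toWitnessFalse x≢0))

  2≤size : ∃ λ m → n ≡ 2 ℕ.+ m
  2≤size = go n enumeration
    where
    go : ∀ n → Carrier ↔ Fin n → ∃ λ m → n ≡ 2 ℕ.+ m
    go 0 I with () ← Inverse.to I 0#
    go 1 I = contradiction (↔-injective I (all-equal (Inverse.to I 1#) (Inverse.to I 0#))) 1≢0
      where
      all-equal : (i j : Fin 1) → i ≡ j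
      all-equal zero zero = refl
    go (suc (suc m)) I = m , refl

  n≡1+[n∸1] : n ≡ suc (n ∸ 1)
  n≡1+[n∸1] = trans (proj₂ 2≤size) (cong (λ k → suc (k ∸ 1)) (sym (proj₂ 2≤size)))

  -- Multiplication by x permutes the nonzero elements, so their product Π equals x^(n-1) Π; Π
  -- itself is nonzero and cancels.
  x^[n∸1]≡1 : ∀ {x} → x ≢ 0# → x ^ (n ∸ 1) ≡ 1#
  x^[n∸1]≡1 {x} x≢0 = *-cancelˡ Π≢0 (begin
    Π * x ^ (n ∸ 1)                        ≡⟨ *-comm Π _ ⟩
    x ^ (n ∸ 1) * Π                        ≡⟨ cong (_* Π) (product-replicate (n ∸ 1)) ⟨
    product {n ∸ 1} (const x) * Π          ≡⟨ ∏-distrib-* {n ∸ 1} (const x) unit ⟨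
    product (λ i → x * unit i)             ≡⟨ product-reindex NonZero↔ (scale x≢0) proj₁ ⟨
    Π                                      ≡⟨ *-identityʳ Π ⟨
    Π * 1#                                 ∎)
    where
    unit : Fin (n ∸ 1) → Carrier
    unit i = proj₁ (Inverse.from NonZero↔ i)
    Π : Carrier
    Π = product unit
    Π≢0 : Π ≢ 0#
    Π≢0 Π≡0 = let i , eq = product-zero unit Π≡0 in
      toWitnessFalse (proj₂ (Inverse.from NonZero↔ i)) eq

  x^n≡x : ∀ x → x ^ n ≡ x
  x^n≡x x = trans (cong (λ k → x ^ k) n≡1+[n∸1]) (go (x ≟ 0#))
    where
    go : Dec (x ≡ 0#) → x * x ^ (n ∸ 1) ≡ x
    go (yes x≡0) = trans (cong (_* x ^ (n ∸ 1)) x≡0) (trans (zeroˡ _) (sym x≡0))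
    go (no  x≢0) = trans (cong (x *_) (x^[n∸1]≡1 x≢0)) (*-identityʳ x)

  -- The monic polynomial of degree m with the given lower coefficients,
  -- starting from the constant one.
  monic : ∀ {m} → Vec Carrier m → Carrier → Carrier
  monic []       x = 1#
  monic (c ∷ cs) x = c + x * monic cs x

  -- Horner's scheme: the coefficients of the quotient by X - r are the values at r of the truncated
  -- polynomials.
  quotient : ∀ {m} → Vec Carrier (suc m) → Carrier → Vec Carrier m
  quotient (c ∷ [])         r = []
  quotient (c ∷ cs@(_ ∷ _)) r = monic cs r ∷ quotient cs r

  synthetic-division : ∀ {m} (cs : Vec Carrier (suc m)) r x →
                       monic cs x ≡ monic cs r + (x - r) * monic (quotient cs r) x
  synthetic-division (c ∷ []) r x =
    solve 3 (λ c r x → c :+ x :* con 1ℤ ⊜ c :+ r :* con 1ℤ :+ (x :+ :- r) :* con 1ℤ) refl c r x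
  synthetic-division (c ∷ cs@(_ ∷ _)) r x = trans
    (cong (λ y → c + x * y) (synthetic-division cs r x))
    (solve 5 (λ c r x y z →
      c :+ x :* (y :+ (x :+ :- r) :* z) ⊜ c :+ r :* y :+ (x :+ :- r) :* (y :+ x :* z)) refl
      c r x (monic cs r) (monic (quotient cs r) x))

  -- Dividing by X - r₀ keeps the other roots, as rᵢ - r₀ is not a zero divisor. There are as many
  -- roots as the degree, so the last quotient is the constant 1.
  monic-factors : ∀ {m} (cs : Vec Carrier m) (r : Fin m → Carrier) →
                  (∀ {i j} → r i ≡ r j → i ≡ j) → (∀ i → monic cs (r i) ≡ 0#) →
                  ∀ x → monic cs x ≡ product (λ i → x - r i)
  monic-factors []       r r-injective root x = refl
  monic-factors cs@(_ ∷ _) r r-injective root x = begin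
    monic cs x
      ≡⟨ divide x ⟩
    (x - r zero) * monic (quotient cs (r zero)) x
      ≡⟨ cong ((x - r zero) *_) (monic-factors (quotient cs (r zero)) (r ∘ suc)
           (λ eq → suc-injective (r-injective eq)) root′ x) ⟩
    (x - r zero) * product (λ i → x - r (suc i))
      ∎
    where
    open import Data.Fin.Properties using (suc-injective)
    divide : ∀ x → monic cs x ≡ (x - r zero) * monic (quotient cs (r zero)) x
    divide x = trans (synthetic-division cs (r zero) x)
      (trans (cong (_+ (x - r zero) * monic (quotient cs (r zero)) x) (root zero)) (+-identityˡ _))
    root′ : ∀ i → monic (quotient cs (r zero)) (r (suc i)) ≡ 0#
    root′ i with zero-product (trans (sym (divide (r (suc i)))) (root (suc i)))
    ... | inj₁ eq = contradiction (r-injective (x-y≡0⇒x≡y eq)) (λ ())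
    ... | inj₂ eq = eq

-- Conjugation on the quadratic extension.

module ExtensionProperties {q : ℕ} {F : FiniteField q} (E∕F : QuadraticExtension F) where
  private
    module F = FieldProperties F
    module FS = IntegerSolver F.commutativeRing
  open QuadraticExtension E∕F public
  open FieldProperties E
  open IntegerSolver commutativeRing using (solve; _⊜_)
  open IsRingHomomorphism isRingHomomorphism public
    using (+-homo; *-homo; -‿homo; 0#-homo; 1#-homo)

  -- If x - y were nonzero, its inverse would force 1 = 0 in `E`.
  ι-injective : ∀ {x y} → ι x ≡ ι y → x ≡ y
  ι-injective {x} {y} ιx≡ιy with (x F.- y) F.≟ F.0#
  ... | yes eq = F.x-y≡0⇒x≡y eq
  ... | no  x-y≢0 with F.inverse _ x-y≢0
  ...   | d , eq = contradiction (begin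
    1#                         ≡⟨ 1#-homo ⟨
    ι F.1#                     ≡⟨ cong ι eq ⟨
    ι ((x F.- y) F.* d)        ≡⟨ *-homo _ d ⟩
    ι (x F.- y) * ι d          ≡⟨ cong (_* ι d) (trans (+-homo x _) (cong (ι x +_) (-‿homo y))) ⟩
    (ι x - ι y) * ι d          ≡⟨ cong (_* ι d) (x≡y⇒x-y≡0 ιx≡ιy) ⟩
    0# * ι d                   ≡⟨ zeroˡ _ ⟩
    0#                         ∎) 1≢0

  ι-^ : ∀ x k → ι (x F.^ k) ≡ ι x ^ k
  ι-^ x zero    = 1#-homo
  ι-^ x (suc k) = trans (*-homo x _) (cong (ι x *_) (ι-^ x k))

  conjugate-ι : ∀ x → conjugate (ι x) ≡ ι x
  conjugate-ι x = trans (sym (ι-^ x q)) (cong ι (F.x^n≡x x))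

  conjugate-involutive : ∀ x → conjugate (conjugate x) ≡ x
  conjugate-involutive x = begin
    (x ^ q) ^ q      ≡⟨ ^-assocʳ x q q ⟩
    x ^ (q ℕ.* q)    ≡⟨ cong (λ k → x ^ (q ℕ.* k)) (ℕ-*-identityʳ q) ⟨
    x ^ (q ℕ.^ 2)    ≡⟨ x^n≡x x ⟩
    x                ∎

  conjugate-* : ∀ x y → conjugate (x * y) ≡ conjugate x * conjugate y
  conjugate-* x y = ^-distrib-* x y q

  element : Fin q → F.Carrier
  element = Inverse.from F.enumeration

  conjugate-minus-id : ∀ x → conjugate x - x ≡ product (λ i → x - ι (element i))
  -- Writing q as 2 + m leaves room for the coefficients of X^q - X in degrees 0 and 1. The q
  -- elements of `F` are roots because x^q = x on `F`, and they stay distinct under `ι`.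
  conjugate-minus-id x with F.2≤size
  ... | m , refl = trans (sym (monic-cs x)) (monic-factors cs (ι ∘ element)
    (λ eq → ↔-injective (↔-sym F.enumeration) (ι-injective eq))
    (λ i → trans (monic-cs _) (x≡y⇒x-y≡0 (conjugate-ι _))) x)
    where
    -- The coefficients of X^q − X.
    cs : Vec Carrier (2 ℕ.+ m)
    cs = 0# ∷ - 1# ∷ replicate m 0#
    monomial : ∀ k y → monic (replicate k 0#) y ≡ y ^ k
    monomial zero    y = refl
    monomial (suc k) y = trans (+-identityˡ _) (cong (y *_) (monomial k y))
    monic-cs : ∀ y → monic cs y ≡ conjugate y - y
    monic-cs y = begin
      0# + y * (- 1# + y * monic (replicate m 0#) y)
        ≡⟨ cong (λ z → 0# + y * (- 1# + y * z)) (monomial m y) ⟩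
      0# + y * (- 1# + y * y ^ m)
        ≡⟨ solve 2 (λ y z → con 0ℤ :+ y :* (:- con 1ℤ :+ y :* z) ⊜ y :* (y :* z) :+ :- y) refl y (y ^ m) ⟩
      y * (y * y ^ m) - y
        ∎

  conjugate-fixed : ∀ {x} → conjugate x ≡ x → ∃ λ y → ι y ≡ x
  conjugate-fixed {x} eq with product-zero _ (trans (sym (conjugate-minus-id x)) (x≡y⇒x-y≡0 eq))
  ... | i , x-ι≡0 = element i , sym (x-y≡0⇒x≡y x-ι≡0)

  conjugate-+1 : ∀ x → conjugate (x + 1#) ≡ conjugate x + 1#
  conjugate-+1 x = begin
    conjugate (x + 1#)
      ≡⟨ solve 2 (λ x y → y ⊜ (y :+ :- (x :+ con 1ℤ)) :+ (x :+ con 1ℤ)) refl x (conjugate (x + 1#)) ⟩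
    (conjugate (x + 1#) - (x + 1#)) + (x + 1#)
      ≡⟨ cong (_+ (x + 1#)) translate ⟩
    (conjugate x - x) + (x + 1#)
      ≡⟨ solve 2 (λ x y → (y :+ :- x) :+ (x :+ con 1ℤ) ⊜ y :+ con 1ℤ) refl x (conjugate x) ⟩
    conjugate x + 1#
      ∎
    where
    shift : F.Carrier ↔ F.Carrier
    shift = mk↔ₛ′ (F._+ F.1#) (F._- F.1#)
      (λ y → FS.solve 1 (λ y → (y :+ :- con 1ℤ) :+ con 1ℤ FS.⊜ y) refl y)
      (λ y → FS.solve 1 (λ y → (y :+ con 1ℤ) :+ :- con 1ℤ FS.⊜ y) refl y)
    translate : conjugate (x + 1#) - (x + 1#) ≡ conjugate x - x
    translate = begin
      conjugate (x + 1#) - (x + 1#)                         ≡⟨ conjugate-minus-id (x + 1#) ⟩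
      product (λ i → (x + 1#) - ι (element i))
        ≡⟨ product-reindex F.enumeration shift (λ c → (x + 1#) - ι c) ⟩
      product (λ i → (x + 1#) - ι (element i F.+ F.1#))     ≡⟨ product-cong (λ i → trans
          (cong (λ c → (x + 1#) - c) (trans (+-homo _ _) (cong (ι (element i) +_) 1#-homo)))
          (solve 2 (λ x c → (x :+ con 1ℤ) :+ :- (c :+ con 1ℤ) ⊜ x :+ :- c) refl x (ι (element i)))) ⟩
      product (λ i → x - ι (element i))                     ≡⟨ conjugate-minus-id x ⟨
      conjugate x - x                                       ∎

  conjugate-0 : conjugate 0# ≡ 0#
  conjugate-0 = trans (cong conjugate (sym 0#-homo)) (trans (conjugate-ι _) 0#-homo)

  conjugate-1 : conjugate 1# ≡ 1#
  conjugate-1 = trans (cong conjugate (sym 1#-homo)) (trans (conjugate-ι _) 1#-homo)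

  -- For y ≠ 0 one has x + y = y(x/y + 1), so multiplicativity reduces additivity to translation by
  -- 1.
  conjugate-+ : ∀ x y → conjugate (x + y) ≡ conjugate x + conjugate y
  conjugate-+ x y with y ≟ 0#
  ... | yes refl = trans (cong conjugate (+-identityʳ x))
    (sym (trans (cong (conjugate x +_) conjugate-0) (+-identityʳ _)))
  ... | no  y≢0 with inverse y y≢0
  ...   | z , yz≡1 = begin
    conjugate (x + y)
      ≡⟨ cong conjugate (factor x (sym yz≡1)) ⟩
    conjugate (y * (z * x + 1#))
      ≡⟨ conjugate-* y (z * x + 1#) ⟩
    conjugate y * conjugate (z * x + 1#)
      ≡⟨ cong (conjugate y *_) (trans (conjugate-+1 (z * x)) (cong (_+ 1#) (conjugate-* z x))) ⟩
    conjugate y * (conjugate z * conjugate x + 1#)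
      ≡⟨ factor (conjugate x) (trans (sym conjugate-1) (trans (cong conjugate (sym yz≡1)) (conjugate-* y z))) ⟨
    conjugate x + conjugate y
      ∎
    where
    -- General in `y` and `z` because it is applied a second time to the conjugates, where z̄ is the
    -- inverse of ȳ.
    factor : ∀ {y z} x → 1# ≡ y * z → x + y ≡ y * (z * x + 1#)
    factor {y} {z} x 1≡yz = begin
      x + y                ≡⟨ cong (_+ y) (*-identityˡ x) ⟨
      1# * x + y           ≡⟨ cong (λ w → w * x + y) 1≡yz ⟩
      (y * z) * x + y      ≡⟨ solve 3 (λ x y z → (y :* z) :* x :+ y ⊜ y :* (z :* x :+ con 1ℤ)) refl x y z ⟩
      y * (z * x + 1#)     ∎

-- Generic over raw rings, so that the same formulas denote both elements of a
-- field and the polynomial expressions handed to the ring solver.  The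
-- operations of Defs are repeated for the latter.
module Formulas (R : RawRing 0ℓ 0ℓ) where
  open RawRing R
  open RawSemiringDefinitions rawSemiring using (_^_) renaming (_×_ to _×ᶠ_)

  infixl 6 _-_
  _-_ : Carrier → Carrier → Carrier
  x - y = x + - y

  infix 7 _∙_
  _∙_ : ∀ {n} → Vec Carrier n → Vec Carrier n → Carrier
  v ∙ w = foldr′ _+_ 0# (zipWith _*_ v w)

  Matrix : Set
  Matrix = Vec (Vec Carrier 3) 3

  _⊗_ : Matrix → Matrix → Matrix
  A ⊗ B = map (λ row → map (row ∙_) (transpose B)) A

  toMatrix : Vec Carrier 6 → Matrix
  toMatrix (y₀ ∷ y₁ ∷ y₂ ∷ y₃ ∷ y₄ ∷ y₅ ∷ []) =
    (y₀ ∷ y₁ ∷ y₂ ∷ []) ∷ (y₁ ∷ y₃ ∷ y₄ ∷ []) ∷ (y₂ ∷ y₄ ∷ y₅ ∷ []) ∷ []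

  𝟏 : Matrix
  𝟏 = (1# ∷ 0# ∷ 0# ∷ []) ∷ (0# ∷ 1# ∷ 0# ∷ []) ∷ (0# ∷ 0# ∷ 1# ∷ []) ∷ []

  infixl 7 _⊛_
  _⊛_ : Vec Carrier 3 → Vec Carrier 3 → Vec Carrier 6
  (a₀ ∷ a₁ ∷ a₂ ∷ []) ⊛ (b₀ ∷ b₁ ∷ b₂ ∷ []) =
      a₀ * b₀ ∷ a₀ * b₁ + a₁ * b₀ ∷ a₀ * b₂ + a₂ * b₀
    ∷ a₁ * b₁ ∷ a₁ * b₂ + a₂ * b₁ ∷ a₂ * b₂ ∷ []

  discriminant : Vec Carrier 6 → Carrier
  discriminant (a₀₀ ∷ a₀₁ ∷ a₀₂ ∷ a₁₁ ∷ a₁₂ ∷ a₂₂ ∷ []) =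
    4 ×ᶠ (a₀₀ * a₁₁ * a₂₂) + a₀₁ * a₀₂ * a₁₂
      - a₀₀ * a₁₂ ^ 2 - a₁₁ * a₀₂ ^ 2 - a₂₂ * a₀₁ ^ 2

  upperTriangle : Matrix → Vec Carrier 6
  upperTriangle ((y₀ ∷ y₁ ∷ y₂ ∷ []) ∷ (_ ∷ y₃ ∷ y₄ ∷ []) ∷ (_ ∷ _ ∷ y₅ ∷ []) ∷ []) =
    y₀ ∷ y₁ ∷ y₂ ∷ y₃ ∷ y₄ ∷ y₅ ∷ []

  congruence : Matrix → Vec Carrier 6 → Matrix
  congruence A y = (A ⊗ toMatrix y) ⊗ transpose A

  infixl 7 _◃_
  -- Row vector times matrix, that is, the linear form x ↦ ℓ(Ax).
  _◃_ : Vec Carrier 3 → Matrix → Vec Carrier 3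
  ℓ ◃ A = map (ℓ ∙_) (transpose A)

  -- The value a(u), as the pairing of a with the rank-one matrix uuᵀ.
  value : Vec Carrier 6 → Vec Carrier 3 → Carrier
  value a u = a ∙ upperTriangle (map (λ x → map (x *_) u) u)

  -- The polarisation a(u + v) - a(u) - a(v), written so that it makes sense in every
  -- characteristic.
  polar : Vec Carrier 6 → Vec Carrier 3 → Vec Carrier 3 → Carrier
  polar a u v = a ∙ upperTriangle (zipWith (λ x y → zipWith _+_ (map (x *_) v) (map (y *_) u)) u v)

  -- The quadratic form x ↦ a(Ax).
  substitute : Vec Carrier 6 → Matrix → Vec Carrier 6
  substitute a A with transpose A
  -- With u, v, w the columns of A, Ax = x₀u + x₁v + x₂w: the squares receive values, the mixed
  -- terms polarisations.
  ... | u ∷ v ∷ w ∷ [] =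
    value a u ∷ polar a u v ∷ polar a u w ∷ value a v ∷ polar a v w ∷ value a w ∷ []

  determinant : Matrix → Carrier
  determinant ((a ∷ b ∷ c ∷ []) ∷ (d ∷ e ∷ f ∷ []) ∷ (g ∷ h ∷ i ∷ []) ∷ []) =
    a * (e * i - f * h) - b * (d * i - f * g) + c * (d * h - e * g)

-- Quadratic and linear forms under linear substitution.

module Forms {q : ℕ} (F : FiniteField q) where
  open FieldProperties F
  open Projective F
  open Formulas rawRing public using (upperTriangle; _◃_; value; polar; substitute; determinant)

  open IntegerSolver commutativeRing

  module P {n} = Formulas (polynomials n)
  module R {n} = RawRing (polynomials n)

  𝕞 : ∀ {n} → ℕ → Vec (Vec (Polynomial (suc n)) 3) 3
  𝕞 k = 𝕧 3 k ∷ 𝕧 3 (3 ℕ.+ k) ∷ 𝕧 3 (6 ℕ.+ k) ∷ []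

  proveⱽ : ∀ {n m} (ρ : Vec Carrier n) (es fs : Vec (Polynomial n) m) →
           map (λ e → ⟦ normalise e ⟧ₚ ρ) es ≡ map (λ e → ⟦ normalise e ⟧ₚ ρ) fs →
           map (λ e → ⟦ e ⟧ ρ) es ≡ map (λ e → ⟦ e ⟧ ρ) fs
  proveⱽ ρ []       []       _  = refl
  proveⱽ ρ (e ∷ es) (f ∷ fs) eq =
    cong₂ _∷_ (prove ρ e f (cong Vec.head eq)) (proveⱽ ρ es fs (cong Vec.tail eq))

  _≟ⱽ_ : ∀ {n} → DecidableEquality (Vec Carrier n)
  _≟ⱽ_ = ≡-dec _≟_

  -- A vector matched against these patterns is an explicit list of coordinates, on which the field
  -- formulas unfold to what the solver's expressions evaluate to.
  pattern vec₃ = _ ∷ _ ∷ _ ∷ []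
  pattern vec₆ = _ ∷ _ ∷ _ ∷ _ ∷ _ ∷ _ ∷ []
  pattern mat₃ = vec₃ ∷ vec₃ ∷ vec₃ ∷ []

  congruence : Matrix → Vec Carrier 6 → Matrix
  congruence A y = (A ⊗ toMatrix y) ⊗ transpose A

  -- Substitution is adjoint to the action on points: when y represents uuᵀ, both sides are a(Au).
  -- This moves incidence between a line and its image.
  substitute-∙ : ∀ a A y → a ∙ upperTriangle (congruence A y) ≡ substitute a A ∙ y
  substitute-∙ a@vec₆ A@mat₃ y@vec₆ = prove (a ++ concat A ++ y)
    (𝕧 6 0 P.∙ P.upperTriangle (P.congruence (𝕞 6) (𝕧 6 15)))
    (P.substitute (𝕧 6 0) (𝕞 6) P.∙ 𝕧 6 15) refl

  substitute-⊛ : ∀ ℓ m A → substitute (ℓ ⊛ m) A ≡ (ℓ ◃ A) ⊛ (m ◃ A)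
  substitute-⊛ ℓ@vec₃ m@vec₃ A@mat₃ = proveⱽ (ℓ ++ m ++ concat A)
    (P.substitute (𝕧 3 0 P.⊛ 𝕧 3 3) (𝕞 6)) ((𝕧 3 0 P.◃ 𝕞 6) P.⊛ (𝕧 3 3 P.◃ 𝕞 6)) refl

  substitute-⊗ : ∀ a A B → substitute (substitute a A) B ≡ substitute a (A ⊗ B)
  substitute-⊗ a@vec₆ A@mat₃ B@mat₃ = proveⱽ (a ++ concat A ++ concat B)
    (P.substitute (P.substitute (𝕧 6 0) (𝕞 6)) (𝕞 15))
    (P.substitute (𝕧 6 0) (𝕞 6 P.⊗ 𝕞 15)) refl

  substitute-𝟏 : ∀ a → substitute a 𝟏 ≡ a
  substitute-𝟏 a@vec₆ = proveⱽ a (P.substitute (𝕧 6 0) P.𝟏) (𝕧 6 0) refl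

  substitute-· : ∀ c a A → substitute (c · a) A ≡ c · substitute a A
  substitute-· c a@vec₆ A@mat₃ = proveⱽ (c ∷ a ++ concat A)
    (P.substitute (map (𝕩 0 R.*_) (𝕧 6 1)) (𝕞 7)) (map (𝕩 0 R.*_) (P.substitute (𝕧 6 1) (𝕞 7))) refl

  substitute-𝟎 : ∀ A → substitute 𝟎 A ≡ 𝟎
  substitute-𝟎 A@mat₃ =
    proveⱽ (concat A) (P.substitute (replicate 6 R.0#) (𝕞 0)) (replicate 6 R.0#) refl

  discriminant-substitute : ∀ a A →
    discriminant (substitute a A) ≡ (determinant A * determinant A) * discriminant a
  discriminant-substitute a@vec₆ A@mat₃ = prove (a ++ concat A)
    (P.discriminant (P.substitute (𝕧 6 0) (𝕞 6)))
    ((P.determinant (𝕞 6) R.* P.determinant (𝕞 6)) R.* P.discriminant (𝕧 6 0)) refl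

  ◃-⊗ : ∀ ℓ A B → (ℓ ◃ A) ◃ B ≡ ℓ ◃ (A ⊗ B)
  ◃-⊗ ℓ@vec₃ A@mat₃ B@mat₃ = proveⱽ (ℓ ++ concat A ++ concat B)
    ((𝕧 3 0 P.◃ 𝕞 3) P.◃ 𝕞 12) (𝕧 3 0 P.◃ (𝕞 3 P.⊗ 𝕞 12)) refl

  ◃-𝟏 : ∀ ℓ → ℓ ◃ 𝟏 ≡ ℓ
  ◃-𝟏 ℓ@vec₃ = proveⱽ ℓ (𝕧 3 0 P.◃ P.𝟏) (𝕧 3 0) refl

  ◃-· : ∀ c ℓ A → (c · ℓ) ◃ A ≡ c · (ℓ ◃ A)
  ◃-· c ℓ@vec₃ A@mat₃ = proveⱽ (c ∷ ℓ ++ concat A)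
    (map (𝕩 0 R.*_) (𝕧 3 1) P.◃ 𝕞 4) (map (𝕩 0 R.*_) (𝕧 3 1 P.◃ 𝕞 4)) refl

  -- `upperTriangle` loses nothing on AMAᵀ, so six coordinates represent the image point and satisfy
  -- the matrix equation in `SameKOrbit`.
  congruence-symmetric : ∀ A y → toMatrix (upperTriangle (congruence A y)) ≡ congruence A y
  congruence-symmetric A@mat₃ y@vec₆ = cong₂ _∷_ refl (cong₂ _∷_
    (cong₂ _∷_ (entry 0F 1F refl) refl)
    (cong (_∷ []) (cong₂ _∷_ (entry 0F 2F refl) (cong₂ _∷_ (entry 1F 2F refl) refl))))
    where
    entry : ∀ i j → _
    entry i j = prove (concat A ++ y)
      (lookup (lookup (P.congruence (𝕞 0) (𝕧 6 9)) i) j)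
      (lookup (lookup (P.congruence (𝕞 0) (𝕧 6 9)) j) i)

  ∙-𝟎 : ∀ (a : Vec Carrier 6) → a ∙ 𝟎 ≡ 0#
  ∙-𝟎 a@vec₆ = prove a (𝕧 6 0 P.∙ replicate 6 R.0#) R.0# refl

  module _ (A B : Matrix) (AB≡𝟏 : A ⊗ B ≡ 𝟏) where

    substitute-inverse : ∀ a → substitute (substitute a A) B ≡ a
    substitute-inverse a = trans (substitute-⊗ a A B) (trans (cong (substitute a) AB≡𝟏) (substitute-𝟏 a))

    ◃-inverse : ∀ ℓ → (ℓ ◃ A) ◃ B ≡ ℓ
    ◃-inverse ℓ = trans (◃-⊗ ℓ A B) (trans (cong (ℓ ◃_) AB≡𝟏) (◃-𝟏 ℓ))

    substitute-≢𝟎 : ∀ a → a ≢ 𝟎 → substitute a A ≢ 𝟎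
    substitute-≢𝟎 a a≢𝟎 eq = a≢𝟎
      (trans (sym (substitute-inverse a)) (trans (cong (λ b → substitute b B) eq) (substitute-𝟎 B)))

    -- Substituting `B` recovers `a`, so the discriminant of `a` is a multiple of that of
    -- `substitute a A`; this replaces a proof that det A is nonzero.
    discriminant-≢0 : ∀ a → discriminant a ≢ 0# → discriminant (substitute a A) ≢ 0#
    discriminant-≢0 a disc≢0 eq = disc≢0 (trans (cong discriminant (sym (substitute-inverse a)))
      (trans (discriminant-substitute (substitute a A) B)
        (trans (cong (determinant B * determinant B *_) eq) (zeroʳ _))))

    ◃-proportional : ∀ ℓ m → Proportional (ℓ ◃ A) (m ◃ A) → Proportional ℓ m
    ◃-proportional ℓ m (c , c≢0 , eq) = c , c≢0 , (begin
      m                    ≡⟨ ◃-inverse m ⟨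
      (m ◃ A) ◃ B          ≡⟨ cong (_◃ B) eq ⟩
      (c · (ℓ ◃ A)) ◃ B    ≡⟨ ◃-· c (ℓ ◃ A) B ⟩
      c · ((ℓ ◃ A) ◃ B)    ≡⟨ cong (c ·_) (◃-inverse ℓ) ⟩
      c · ℓ                ∎)

-- Homomorphisms commute with substitution.

module FormHomomorphism
  {q r : ℕ} {F : FiniteField q} {K : FiniteField r}
  (φ : FiniteField.Carrier F → FiniteField.Carrier K)
  (+-homo : ∀ x y → φ (FiniteField._+_ F x y) ≡ FiniteField._+_ K (φ x) (φ y))
  (*-homo : ∀ x y → φ (FiniteField._*_ F x y) ≡ FiniteField._*_ K (φ x) (φ y))
  (0-homo : φ (FiniteField.0# F) ≡ FiniteField.0# K)
  where
  private
    module F = FiniteField F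
    module K = FiniteField K
    module PF = Projective F
    module PK = Projective K
    module FF = Forms F
    module FK = Forms K

  ∙-homo : ∀ {n} (v w : Vec F.Carrier n) → φ (v PF.∙ w) ≡ map φ v PK.∙ map φ w
  ∙-homo []      []      = 0-homo
  ∙-homo (x ∷ v) (y ∷ w) = trans (+-homo _ _) (cong₂ K._+_ (*-homo x y) (∙-homo v w))

  ◃-homo : ∀ ℓ A → map φ (ℓ FF.◃ A) ≡ map φ ℓ FK.◃ map (map φ) A
  ◃-homo ℓ ((a ∷ b ∷ c ∷ []) ∷ (d ∷ e ∷ f ∷ []) ∷ (g ∷ h ∷ i ∷ []) ∷ []) =
    cong₂ _∷_ (∙-homo ℓ (a ∷ d ∷ g ∷ [])) (cong₂ _∷_ (∙-homo ℓ (b ∷ e ∷ h ∷ []))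
      (cong (_∷ []) (∙-homo ℓ (c ∷ f ∷ i ∷ []))))

  ⊗-homo : ∀ A B → map (map φ) (A PF.⊗ B) ≡ map (map φ) A PK.⊗ map (map φ) B
  ⊗-homo (u ∷ v ∷ w ∷ []) B =
    cong₂ _∷_ (◃-homo u B) (cong₂ _∷_ (◃-homo v B) (cong (_∷ []) (◃-homo w B)))

  value-homo : ∀ a u → φ (FF.value a u) ≡ FK.value (map φ a) (map φ u)
  value-homo a u@(x ∷ y ∷ z ∷ []) = trans (∙-homo a (FF.upperTriangle (map (λ x → map (x F.*_) u) u)))
    (cong (map φ a PK.∙_) (cong₂ _∷_ (*-homo x x) (cong₂ _∷_ (*-homo x y) (cong₂ _∷_ (*-homo x z)
      (cong₂ _∷_ (*-homo y y) (cong₂ _∷_ (*-homo y z) (cong (_∷ []) (*-homo z z))))))))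

  polar-homo : ∀ a u v → φ (FF.polar a u v) ≡ FK.polar (map φ a) (map φ u) (map φ v)
  polar-homo a u@(x ∷ y ∷ z ∷ []) v@(x′ ∷ y′ ∷ z′ ∷ []) = trans
    (∙-homo a (FF.upperTriangle
      (zipWith (λ x y → zipWith F._+_ (map (x F.*_) v) (map (y F.*_) u)) u v)))
    (cong (map φ a PK.∙_) (cong₂ _∷_ (h x x′ x′ x) (cong₂ _∷_ (h x y′ x′ y) (cong₂ _∷_ (h x z′ x′ z)
      (cong₂ _∷_ (h y y′ y′ y) (cong₂ _∷_ (h y z′ y′ z) (cong (_∷ []) (h z z′ z′ z))))))))
    where
    h : ∀ p q r s → φ (p F.* q F.+ r F.* s) ≡ φ p K.* φ q K.+ φ r K.* φ s
    h p q r s = trans (+-homo _ _) (cong₂ K._+_ (*-homo p q) (*-homo r s))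

  -- Applied to `ι`, this carries a substitution over `F` to `E`, where the imaginary factors live.
  substitute-homo : ∀ a A → map φ (FF.substitute a A) ≡ FK.substitute (map φ a) (map (map φ) A)
  substitute-homo a ((x ∷ y ∷ z ∷ []) ∷ (x′ ∷ y′ ∷ z′ ∷ []) ∷ (x″ ∷ y″ ∷ z″ ∷ []) ∷ []) =
    cong₂ _∷_ (value-homo a u) (cong₂ _∷_ (polar-homo a u v) (cong₂ _∷_ (polar-homo a u w)
      (cong₂ _∷_ (value-homo a v) (cong₂ _∷_ (polar-homo a v w) (cong (_∷ []) (value-homo a w))))))
    where
    u = x ∷ x′ ∷ x″ ∷ []
    v = y ∷ y′ ∷ y″ ∷ []
    w = z ∷ z′ ∷ z″ ∷ []

-- Invariance of the four orbits and transport from the representative line.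

module Transport {q : ℕ} {F : FiniteField q} (E∕F : QuadraticExtension F) where
  open ExtensionProperties E∕F
  private module E = FieldProperties E
  open HyperplaneOrbits E∕F
  open FiniteField F using (Carrier; _*_)
  open Projective F
  open Forms F
  module FE = Forms E

  Invariant : (QuadraticForm → Set) → Set
  Invariant 𝓗 = ∀ A B → A ⊗ B ≡ 𝟏 → ∀ a → 𝓗 a → 𝓗 (substitute a A)

  𝓗₁-invariant : Invariant 𝓗₁
  𝓗₁-invariant A _ _ _ (c , ℓ , refl) =
    c , ℓ ◃ A , trans (substitute-· c (ℓ ⊛ ℓ) A) (cong (c ·_) (substitute-⊛ ℓ ℓ A))

  𝓗₂,ᵣ-invariant : Invariant 𝓗₂,ᵣ
  𝓗₂,ᵣ-invariant A B AB≡𝟏 _ (ℓ , m , ℓ≁m , refl) =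
    ℓ ◃ A , m ◃ A , (λ p → ℓ≁m (◃-proportional A B AB≡𝟏 ℓ m p)) , substitute-⊛ ℓ m A

  -- Conjugation fixes the entries of A, which lie in `F`; hence the conjugate of ℓ(Ax) is ℓ̄(Ax),
  -- and the two factors remain conjugate.
  𝓗₂,ᵢ-invariant : Invariant 𝓗₂,ᵢ
  𝓗₂,ᵢ-invariant A B AB≡𝟏 a (c , ℓ , ℓ≁ℓ̄ , eq) = c , ℓ FE.◃ ιA ,
    (λ p → ℓ≁ℓ̄ (FE.◃-proportional ιA ιB ιAιB≡𝟏 ℓ (map conjugate ℓ)
      (subst (PE.Proportional (ℓ FE.◃ ιA)) conjugate-◃ p))) ,
    (begin
      map ι (substitute a A)
        ≡⟨ ιH.substitute-homo a A ⟩
      FE.substitute (map ι a) ιA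
        ≡⟨ cong (λ b → FE.substitute b ιA) eq ⟩
      FE.substitute (ι c PE.· (ℓ PE.⊛ map conjugate ℓ)) ιA
        ≡⟨ FE.substitute-· (ι c) (ℓ PE.⊛ map conjugate ℓ) ιA ⟩
      ι c PE.· FE.substitute (ℓ PE.⊛ map conjugate ℓ) ιA
        ≡⟨ cong (ι c PE.·_) (FE.substitute-⊛ ℓ (map conjugate ℓ) ιA) ⟩
      ι c PE.· ((ℓ FE.◃ ιA) PE.⊛ (map conjugate ℓ FE.◃ ιA))
        ≡⟨ cong (λ m → ι c PE.· ((ℓ FE.◃ ιA) PE.⊛ m)) conjugate-◃ ⟨
      ι c PE.· ((ℓ FE.◃ ιA) PE.⊛ map conjugate (ℓ FE.◃ ιA))
        ∎)
    where
    module ιH = FormHomomorphism {F = F} {K = E} ι +-homo *-homo 0#-homo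
    module cH = FormHomomorphism {F = E} {K = E} conjugate conjugate-+ conjugate-* conjugate-0
    ιA ιB : PE.Matrix
    ιA = map (map ι) A
    ιB = map (map ι) B
    ι𝟏≡𝟏 : map (map ι) 𝟏 ≡ PE.𝟏
    ι𝟏≡𝟏 = cong₂ (λ x y → (x ∷ y ∷ y ∷ []) ∷ (y ∷ x ∷ y ∷ []) ∷ (y ∷ y ∷ x ∷ []) ∷ []) 1#-homo 0#-homo
    ιAιB≡𝟏 : ιA PE.⊗ ιB ≡ PE.𝟏
    ιAιB≡𝟏 = trans (sym (ιH.⊗-homo A B)) (trans (cong (map (map ι)) AB≡𝟏) ι𝟏≡𝟏)
    conjugate-ιA : map (map conjugate) ιA ≡ ιA
    conjugate-ιA = trans (sym (map-∘ _ _ A)) (map-cong (λ v →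
      trans (sym (map-∘ _ _ v)) (map-cong conjugate-ι v)) A)
    conjugate-◃ : map conjugate (ℓ FE.◃ ιA) ≡ map conjugate ℓ FE.◃ ιA
    conjugate-◃ = trans (cH.◃-homo ℓ ιA)
      (cong (map conjugate ℓ FE.◃_) conjugate-ιA)

  𝓗₃-invariant : Invariant 𝓗₃
  𝓗₃-invariant = discriminant-≢0

  module _ (L : Line 5) (L∈o₆ : o₆ L) where
    private
      A B : Matrix
      A = proj₁ (proj₁ L∈o₆)
      B = proj₁ (proj₂ (proj₁ L∈o₆))
      AB≡𝟏 : A ⊗ B ≡ 𝟏
      AB≡𝟏 = proj₁ (proj₂ (proj₂ (proj₁ L∈o₆)))
      BA≡𝟏 : B ⊗ A ≡ 𝟏
      BA≡𝟏 = proj₂ (proj₂ (proj₂ (proj₁ L∈o₆)))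

    contains-image⇒ : ∀ a → Contains a L → Contains (substitute a A) o₆-representative
    contains-image⇒ a a⊇L R R∈ = trans (sym (substitute-∙ a A (proj₁ R))) (go (S ≟ⱽ 𝟎))
      where
      S : Vec Carrier 6
      S = upperTriangle (congruence A (proj₁ R))
      -- Only a nonzero vector is a point of `L`. The zero case is harmless, as every form vanishes
      -- there, so invertibility of the action is not invoked.
      go : Dec (S ≡ 𝟎) → a ∙ S ≡ FiniteField.0# F
      go (yes S≡𝟎) = trans (cong (a ∙_) S≡𝟎) (∙-𝟎 a)
      go (no  S≢𝟎) = a⊇L (S , S≢𝟎)
        (Equivalence.from (proj₂ L∈o₆ (S , S≢𝟎)) (R , R∈ , congruence-symmetric A (proj₁ R)))

    contains-image⇐ : ∀ a → Contains (substitute a A) o₆-representative → Contains a L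
    -- Matching on the coordinates makes `upperTriangle (toMatrix y)` reduce to `y`.
    contains-image⇐ a a′⊇ S@(y@vec₆ , _) S∈L with Equivalence.to (proj₂ L∈o₆ S) S∈L
    ... | R , R∈ , eq = trans (cong (a ∙_) (cong upperTriangle eq))
      (trans (substitute-∙ a A (proj₁ R)) (a′⊇ R R∈))

    HyperplanesThrough-image : ∀ {𝓗} → Invariant 𝓗 →
      Inverse (HyperplanesThrough L 𝓗) (HyperplanesThrough o₆-representative 𝓗)
    HyperplanesThrough-image {𝓗} invariant = record
      { to        = λ ((a , a≢𝟎) , a⊇L , 𝓗a) →
          (substitute a A , substitute-≢𝟎 A B AB≡𝟏 a a≢𝟎) , contains-image⇒ a a⊇L , invariant A B AB≡𝟏 a 𝓗a
      ; from      = λ ((a , a≢𝟎) , a⊇ , 𝓗a) →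
          (substitute a B , substitute-≢𝟎 B A BA≡𝟏 a a≢𝟎)
          , contains-image⇐ (substitute a B)
              (subst (λ b → Contains b o₆-representative) (sym (substitute-inverse B A BA≡𝟏 a)) a⊇)
          , invariant B A BA≡𝟏 a 𝓗a
      ; to-cong   = substitute-cong A
      ; from-cong = substitute-cong B
      ; inverse   =
          (λ {((a , _) , _)} {((b , _) , _)} p →
            subst (λ c → Proportional (substitute b A) c)
              (substitute-inverse B A BA≡𝟏 a) (substitute-cong A p))
        , (λ {((a , _) , _)} {((b , _) , _)} p →
            subst (λ c → Proportional (substitute b B) c)
              (substitute-inverse A B AB≡𝟏 a) (substitute-cong B p))
      }
      where
      substitute-cong : ∀ A {a b} → Proportional a b → Proportional (substitute a A) (substitute b A)
      substitute-cong A {a} (c , c≢0 , refl) = c , c≢0 , substitute-· c a A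

    HasSize-image : ∀ {𝓗 n} → Invariant 𝓗 →
      HasSize (HyperplanesThrough o₆-representative 𝓗) n → HasSize (HyperplanesThrough L 𝓗) n
    HasSize-image invariant size = ∘-inverse (HyperplanesThrough-image invariant) size

-- Binary forms over either field: roots and unique factorisation.

module BinaryForms {n : ℕ} (K : FiniteField n) where
  open FieldProperties K
  open Projective K
  open Forms K
  open IntegerSolver commutativeRing using (prove; Polynomial; 𝕩; 𝕧)

  value-⊛ : ∀ ℓ m u → value (ℓ ⊛ m) u ≡ (ℓ ∙ u) * (m ∙ u)
  value-⊛ ℓ@vec₃ m@vec₃ u@vec₃ = prove (ℓ ++ m ++ u)
    (P.value (𝕧 3 0 P.⊛ 𝕧 3 3) (𝕧 3 6)) ((𝕧 3 0 P.∙ 𝕧 3 6) R.* (𝕧 3 3 P.∙ 𝕧 3 6)) refl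

  value-· : ∀ c a u → value (c · a) u ≡ c * value a u
  value-· c a@vec₆ u@vec₃ = prove (c ∷ a ++ u)
    (P.value (map (𝕩 0 R.*_) (𝕧 6 1)) (𝕧 3 7)) (𝕩 0 R.* P.value (𝕧 6 1) (𝕧 3 7)) refl

  ⊛-comm : ∀ ℓ m → ℓ ⊛ m ≡ m ⊛ ℓ
  ⊛-comm ℓ@vec₃ m@vec₃ = proveⱽ (ℓ ++ m) (𝕧 3 0 P.⊛ 𝕧 3 3) (𝕧 3 3 P.⊛ 𝕧 3 0) refl

  ·-⊛-· : ∀ c d ℓ m → (c · ℓ) ⊛ (d · m) ≡ (c * d) · (ℓ ⊛ m)
  ·-⊛-· c d ℓ@vec₃ m@vec₃ = proveⱽ (c ∷ d ∷ ℓ ++ m)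
    (map (𝕩 0 R.*_) (𝕧 3 2) P.⊛ map (𝕩 1 R.*_) (𝕧 3 5))
    (map ((𝕩 0 R.* 𝕩 1) R.*_) (𝕧 3 2 P.⊛ 𝕧 3 5)) refl

  ·-· : ∀ {m} c d (v : Vec Carrier m) → c · d · v ≡ (c * d) · v
  ·-· c d v = trans (sym (map-∘ (c *_) (d *_) v)) (map-cong (λ x → sym (*-assoc c d x)) v)

  1· : ∀ {m} (v : Vec Carrier m) → 1# · v ≡ v
  1· []      = refl
  1· (x ∷ v) = cong₂ _∷_ (*-identityˡ x) (1· v)

  0· : ∀ {m} (v : Vec Carrier m) → 0# · v ≡ 𝟎
  0· []      = refl
  0· (x ∷ v) = cong₂ _∷_ (zeroˡ x) (0· v)

  ·𝟎 : ∀ c → c · 𝟎 {6} ≡ 𝟎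
  ·𝟎 c = cong (replicate 6) (zeroʳ c)

  𝟎⊛ : ∀ ℓ → 𝟎 ⊛ ℓ ≡ 𝟎
  𝟎⊛ ℓ@vec₃ = proveⱽ ℓ (replicate 3 R.0# P.⊛ 𝕧 3 0) (replicate 6 R.0#) refl

  Direction : Set
  Direction = Carrier ⊎ ⊤

  Direction↔ : Direction ↔ Fin (n ℕ.+ 1)
  Direction↔ = ↔-sym +↔⊎ ↔-∘ (enumeration ⊎-↔ ↔-sym 1↔⊤)

  _≟ᴰ_ : DecidableEquality Direction
  _≟ᴰ_ = via-injection (↔⇒↣ Direction↔) _≟ᶠ_

  -- Normalised linear forms in X₁ and X₂: the points of PG(1,q).
  linear : Direction → LinearForm
  linear (inj₁ t) = 0# ∷ 1# ∷ t ∷ []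
  linear (inj₂ _) = 0# ∷ 0# ∷ 1# ∷ []

  -- The zero of `linear p` on the line X₀ = 0; vanishing there characterises `p` among all
  -- directions.
  root : Direction → Vec Carrier 3
  root (inj₁ t) = 0# ∷ - t ∷ 1# ∷ []
  root (inj₂ _) = 0# ∷ 1# ∷ 0# ∷ []

  linear-root : ∀ p → linear p ∙ root p ≡ 0#
  linear-root (inj₁ t) = prove (t ∷ [])
    ((R.0# ∷ R.1# ∷ 𝕩 0 ∷ []) P.∙ (R.0# ∷ R.- 𝕩 0 ∷ R.1# ∷ [])) R.0# refl
  linear-root (inj₂ _) = prove []
    ((R.0# ∷ R.0# ∷ R.1# ∷ []) P.∙ (R.0# ∷ R.1# ∷ R.0# ∷ [])) R.0# refl

  root-unique : ∀ p r → linear r ∙ root p ≡ 0# → r ≡ p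
  root-unique (inj₁ t) (inj₁ s) eq = cong inj₁ (x-y≡0⇒x≡y (trans (sym (prove (t ∷ s ∷ [])
    ((R.0# ∷ R.1# ∷ 𝕩 1 ∷ []) P.∙ (R.0# ∷ R.- 𝕩 0 ∷ R.1# ∷ [])) (𝕩 1 R.+ R.- 𝕩 0) refl)) eq))
  root-unique (inj₁ t) (inj₂ _) eq = contradiction (trans (sym (prove (t ∷ [])
    ((R.0# ∷ R.0# ∷ R.1# ∷ []) P.∙ (R.0# ∷ R.- 𝕩 0 ∷ R.1# ∷ [])) R.1# refl)) eq) 1≢0
  root-unique (inj₂ _) (inj₁ s) eq = contradiction (trans (sym (prove (s ∷ [])
    ((R.0# ∷ R.1# ∷ 𝕩 0 ∷ []) P.∙ (R.0# ∷ R.1# ∷ R.0# ∷ [])) R.1# refl)) eq) 1≢0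
  root-unique (inj₂ _) (inj₂ _) eq = refl

  -- Proportional products have the same zeros, and a product vanishes only where a factor does.
  common-factor : ∀ p p′ r r′ u → (linear p ∙ u) * (linear p′ ∙ u) ≡ 0# →
                  Proportional (linear p ⊛ linear p′) (linear r ⊛ linear r′) →
                  linear r ∙ u ≡ 0# ⊎ linear r′ ∙ u ≡ 0#
  common-factor p p′ r r′ u eq (c , _ , r⊛r′≡) = zero-product (begin
    (linear r ∙ u) * (linear r′ ∙ u)              ≡⟨ value-⊛ (linear r) (linear r′) u ⟨
    value (linear r ⊛ linear r′) u                ≡⟨ cong (λ a → value a u) r⊛r′≡ ⟩
    value (c · (linear p ⊛ linear p′)) u          ≡⟨ value-· c (linear p ⊛ linear p′) u ⟩
    c * value (linear p ⊛ linear p′) u            ≡⟨ cong (c *_) (value-⊛ (linear p) (linear p′) u) ⟩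
    c * ((linear p ∙ u) * (linear p′ ∙ u))        ≡⟨ cong (c *_) eq ⟩
    c * 0#                                        ≡⟨ zeroʳ c ⟩
    0#                                            ∎)

  linear⊛linear : ∀ s t → linear (inj₁ s) ⊛ linear (inj₁ t) ≡ 0# ∷ 0# ∷ 0# ∷ 1# ∷ s + t ∷ s * t ∷ []
  linear⊛linear s t = proveⱽ (s ∷ t ∷ [])
    ((R.0# ∷ R.1# ∷ 𝕩 0 ∷ []) P.⊛ (R.0# ∷ R.1# ∷ 𝕩 1 ∷ []))
    (R.0# ∷ R.0# ∷ R.0# ∷ R.1# ∷ 𝕩 0 R.+ 𝕩 1 ∷ 𝕩 0 R.* 𝕩 1 ∷ []) refl

  linear⊛linear≢𝟎 : ∀ p r → linear p ⊛ linear r ≢ 𝟎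
  linear⊛linear≢𝟎 (inj₁ s) (inj₁ t) eq =
    1≢0 (trans (sym (*-identityˡ 1#)) (cong (λ a → lookup a 3F) eq))
  linear⊛linear≢𝟎 (inj₁ s) (inj₂ _) eq = 1≢0 (trans (sym (prove (s ∷ [])
    (R.1# R.* R.1# R.+ 𝕩 0 R.* R.0#) R.1# refl)) (cong (λ a → lookup a 4F) eq))
  linear⊛linear≢𝟎 (inj₂ _) (inj₁ t) eq = 1≢0 (trans (sym (prove (t ∷ [])
    (R.0# R.* 𝕩 0 R.+ R.1# R.* R.1#) R.1# refl)) (cong (λ a → lookup a 4F) eq))
  linear⊛linear≢𝟎 (inj₂ _) (inj₂ _) eq =
    1≢0 (trans (sym (*-identityˡ 1#)) (cong (λ a → lookup a 5F) eq))

  Proportional-sym : ∀ {m} {v w : Vec Carrier m} → Proportional v w → Proportional w v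
  Proportional-sym {v = v} (c , c≢0 , refl) with inverse c c≢0
  ... | d , cd≡1 = d , inverse-nonzero cd≡1 , sym (trans (·-· d c v)
    (trans (cong (_· v) (trans (*-comm d c) cd≡1)) (1· v)))

  ≁-linear : ∀ {p r} → p ≢ r → ¬ Proportional (linear p) (linear r)
  ≁-linear {p} {r} p≢r (c , _ , eq) = p≢r (sym (root-unique p r (begin
    linear r ∙ root p          ≡⟨ cong (_∙ root p) eq ⟩
    (c · linear p) ∙ root p    ≡⟨ ·-∙ c (linear p) (root p) ⟩
    c * (linear p ∙ root p)    ≡⟨ cong (c *_) (linear-root p) ⟩
    c * 0#                     ≡⟨ zeroʳ c ⟩
    0#                         ∎)))
    where
    ·-∙ : ∀ c (ℓ u : Vec Carrier 3) → (c · ℓ) ∙ u ≡ c * (ℓ ∙ u)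
    ·-∙ c ℓ@vec₃ u@vec₃ = prove (c ∷ ℓ ++ u)
      (map (𝕩 0 R.*_) (𝕧 3 1) P.∙ 𝕧 3 4) (𝕩 0 R.* (𝕧 3 1 P.∙ 𝕧 3 4)) refl

  ⊛-proportional : ∀ {ℓ m ℓ′ m′} → Proportional ℓ ℓ′ → Proportional m m′ → Proportional (ℓ ⊛ m) (ℓ′ ⊛ m′)
  ⊛-proportional {ℓ} {m} (c , c≢0 , refl) (d , d≢0 , refl) = c * d , *-nonzero c≢0 d≢0 , ·-⊛-· c d ℓ m

  Proportional-trans : ∀ {m} {u v w : Vec Carrier m} → Proportional u v → Proportional v w → Proportional u w
  Proportional-trans {u = u} (c , c≢0 , refl) (d , d≢0 , refl) = d * c , *-nonzero d≢0 c≢0 , ·-· d c u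

  -- Only zeros are compared: each root of one product is a root of the other. Both directions are
  -- used, since for p = p′ the inclusion of {p, p′} in {r, r′} leaves one of r, r′ open.
  unique-factorisation : ∀ p p′ r r′ → Proportional (linear p ⊛ linear p′) (linear r ⊛ linear r′) →
                         (p ≡ r × p′ ≡ r′) ⊎ (p ≡ r′ × p′ ≡ r)
  unique-factorisation p p′ r r′ prop = combine at-p at-p′ at-r at-r′
    where
    left : ∀ p p′ → (linear p ∙ root p) * (linear p′ ∙ root p) ≡ 0#
    left p p′ = trans (cong (_* (linear p′ ∙ root p)) (linear-root p)) (zeroˡ _)
    right : ∀ p p′ → (linear p ∙ root p′) * (linear p′ ∙ root p′) ≡ 0#
    right p p′ = trans (cong ((linear p ∙ root p′) *_) (linear-root p′)) (zeroʳ _)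
    roots : ∀ s r r′ → linear r ∙ root s ≡ 0# ⊎ linear r′ ∙ root s ≡ 0# → r ≡ s ⊎ r′ ≡ s
    roots s r r′ (inj₁ eq) = inj₁ (root-unique s r eq)
    roots s r r′ (inj₂ eq) = inj₂ (root-unique s r′ eq)
    at-p : r ≡ p ⊎ r′ ≡ p
    at-p = roots p r r′ (common-factor p p′ r r′ (root p) (left p p′) prop)
    at-p′ : r ≡ p′ ⊎ r′ ≡ p′
    at-p′ = roots p′ r r′ (common-factor p p′ r r′ (root p′) (right p p′) prop)
    at-r : p ≡ r ⊎ p′ ≡ r
    at-r = roots r p p′ (common-factor r r′ p p′ (root r) (left r r′) (Proportional-sym prop))
    at-r′ : p ≡ r′ ⊎ p′ ≡ r′
    at-r′ = roots r′ p p′ (common-factor r r′ p p′ (root r′) (right r r′) (Proportional-sym prop))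
    combine : r ≡ p ⊎ r′ ≡ p → r ≡ p′ ⊎ r′ ≡ p′ → p ≡ r ⊎ p′ ≡ r → p ≡ r′ ⊎ p′ ≡ r′ →
              (p ≡ r × p′ ≡ r′) ⊎ (p ≡ r′ × p′ ≡ r)
    combine (inj₁ refl) (inj₂ refl) _            _            = inj₁ (refl , refl)
    combine (inj₁ refl) (inj₁ refl) _            (inj₁ refl)  = inj₁ (refl , refl)
    combine (inj₁ refl) (inj₁ refl) _            (inj₂ refl)  = inj₁ (refl , refl)
    combine (inj₂ refl) (inj₁ refl) _            _            = inj₂ (refl , refl)
    combine (inj₂ refl) (inj₂ refl) (inj₁ refl)  _            = inj₂ (refl , refl)
    combine (inj₂ refl) (inj₂ refl) (inj₂ refl)  _            = inj₂ (refl , refl)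

  normalised : ∀ {x y z} → x ≡ 0# → x ∷ y ∷ z ∷ [] ≢ 𝟎 → ∃ λ p → Proportional (linear p) (x ∷ y ∷ z ∷ [])
  normalised {y = y} {z} refl ≢𝟎 with y ≟ 0# | z ≟ 0#
  ... | yes refl | yes refl = contradiction refl ≢𝟎
  ... | yes refl | no  z≢0  = inj₂ tt , z , z≢0 ,
    cong₂ _∷_ (sym (zeroʳ z)) (cong₂ _∷_ (sym (zeroʳ z)) (cong (_∷ []) (sym (*-identityʳ z))))
  ... | no y≢0   | _ with inverse y y≢0
  ...   | y⁻¹ , yy⁻¹≡1 = inj₁ (y⁻¹ * z) , y , y≢0 ,
    cong₂ _∷_ (sym (zeroʳ y)) (cong₂ _∷_ (sym (*-identityʳ y)) (cong (_∷ []) (sym (cancel-inverse yy⁻¹≡1 z))))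

  Contains-representative⁻ : ∀ {a₀₀ a₀₁ a₀₂ a₁₁ a₁₂ a₂₂} →
    Contains (a₀₀ ∷ a₀₁ ∷ a₀₂ ∷ a₁₁ ∷ a₁₂ ∷ a₂₂ ∷ []) o₆-representative → a₀₀ ≡ 0# × a₀₁ ≡ 0#
  Contains-representative⁻ {a} {b} {c} {d} {e} {f} h =
      trans (sym (prove ρ (𝕧 6 0 P.∙ e₀) (𝕩 0) refl))
        (h (Line.P o₆-representative) (1# , 0# , proveⱽ [] e₀ (on-line R.1# R.0#) refl))
    , trans (sym (prove ρ (𝕧 6 0 P.∙ e₁) (𝕩 1) refl))
        (h (Line.Q o₆-representative) (0# , 1# , proveⱽ [] e₁ (on-line R.0# R.1#) refl))
    where
    ρ : Vec Carrier 6
    ρ = a ∷ b ∷ c ∷ d ∷ e ∷ f ∷ []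
    e₀ e₁ : ∀ {n} → Vec (Polynomial n) 6
    e₀ = R.1# ∷ R.0# ∷ R.0# ∷ R.0# ∷ R.0# ∷ R.0# ∷ []
    e₁ = R.0# ∷ R.1# ∷ R.0# ∷ R.0# ∷ R.0# ∷ R.0# ∷ []
    on-line : ∀ {n} → Polynomial n → Polynomial n → Vec (Polynomial n) 6
    on-line x y = zipWith R._+_ (map (x R.*_) e₀) (map (y R.*_) e₁)

  Contains-representative⁺ : ∀ {a₀₀ a₀₁ a₀₂ a₁₁ a₁₂ a₂₂} → a₀₀ ≡ 0# → a₀₁ ≡ 0# →
    Contains (a₀₀ ∷ a₀₁ ∷ a₀₂ ∷ a₁₁ ∷ a₁₂ ∷ a₂₂ ∷ []) o₆-representative
  Contains-representative⁺ {a₀₂ = c} {d} {e} {f} refl refl (_ , _) (x , y , refl) =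
    prove (c ∷ d ∷ e ∷ f ∷ x ∷ y ∷ []) ((R.0# ∷ R.0# ∷ 𝕧 4 0) P.∙ zipWith R._+_
      (map (𝕩 4 R.*_) (R.1# ∷ R.0# ∷ R.0# ∷ R.0# ∷ R.0# ∷ R.0# ∷ []))
      (map (𝕩 5 R.*_) (R.0# ∷ R.1# ∷ R.0# ∷ R.0# ∷ R.0# ∷ R.0# ∷ []))) R.0# refl

-- Hyperplanes through the representative line, orbit by orbit.

module RepresentativeSizes {q : ℕ} {F : FiniteField q} (E∕F : QuadraticExtension F) where
  open FieldProperties F
  open ExtensionProperties E∕F
  open HyperplaneOrbits E∕F
  open Projective F
  open Forms F
  open IntegerSolver commutativeRing using (prove; 𝕩; 𝕧)
  open BinaryForms F
  private
    module E = FieldProperties E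
    module BE = BinaryForms E

  Through : (QuadraticForm → Set) → Setoid _ _
  Through = HyperplanesThrough o₆-representative

  linear⊛linear-Contains : ∀ p r → Contains (linear p ⊛ linear r) o₆-representative
  linear⊛linear-Contains (inj₁ s) (inj₁ t) = Contains-representative⁺ (zeroˡ 0#) zeros
    where zeros = prove [] (R.0# R.* R.1# R.+ R.1# R.* R.0#) R.0# refl
  linear⊛linear-Contains (inj₁ s) (inj₂ _) = Contains-representative⁺ (zeroˡ 0#) zeros
    where zeros = prove [] (R.0# R.* R.0# R.+ R.1# R.* R.0#) R.0# refl
  linear⊛linear-Contains (inj₂ _) (inj₁ t) = Contains-representative⁺ (zeroˡ 0#) zeros
    where zeros = prove [] (R.0# R.* R.1# R.+ R.0# R.* R.0#) R.0# refl
  linear⊛linear-Contains (inj₂ _) (inj₂ _) = Contains-representative⁺ (zeroˡ 0#) zeros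
    where zeros = prove [] (R.0# R.* R.0# R.+ R.0# R.* R.0#) R.0# refl

  size-𝓗₁ : HasSize (Through 𝓗₁) (q ℕ.+ 1)
  size-𝓗₁ = HasSize-via (Through 𝓗₁) Direction↔ square square-injective square-surjective
    where
    square : Direction → Setoid.Carrier (Through 𝓗₁)
    square p = (linear p ⊛ linear p , linear⊛linear≢𝟎 p p) , linear⊛linear-Contains p p
             , 1# , linear p , sym (1· _)
    square-injective : ∀ {p r} → Proportional (linear p ⊛ linear p) (linear r ⊛ linear r) → p ≡ r
    square-injective {p} {r} prop with unique-factorisation p p r r prop
    ... | inj₁ (p≡r , _) = p≡r
    ... | inj₂ (p≡r , _) = p≡r
    square-surjective : ∀ (a : Setoid.Carrier (Through 𝓗₁)) →
                        ∃ λ p → Proportional (linear p ⊛ linear p) (proj₁ (proj₁ a))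
    square-surjective ((_ , a≢𝟎) , a⊇ , c , ℓ@(x ∷ y ∷ z ∷ []) , refl) =
      p , Proportional-trans (⊛-proportional ℓ~p ℓ~p) (c , c≢0 , refl)
      where
      c≢0 : c ≢ 0#
      c≢0 c≡0 = a≢𝟎 (trans (cong (_· (ℓ ⊛ ℓ)) c≡0) (0· (ℓ ⊛ ℓ)))
      -- The coefficient a₀₀ is cx², with c ≠ 0.
      x≡0 : x ≡ 0#
      x≡0 with zero-product (proj₁ (Contains-representative⁻ a⊇))
      ... | inj₁ c≡0 = contradiction c≡0 c≢0
      ... | inj₂ xx≡0 with zero-product xx≡0
      ...   | inj₁ eq = eq
      ...   | inj₂ eq = eq
      ℓ≢𝟎 : ℓ ≢ 𝟎
      ℓ≢𝟎 ℓ≡𝟎 = a≢𝟎 (trans (cong (c ·_) (trans (cong (_⊛ ℓ) ℓ≡𝟎) (𝟎⊛ ℓ))) (·𝟎 c))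
      p : Direction
      p = proj₁ (normalised x≡0 ℓ≢𝟎)
      ℓ~p : Proportional (linear p) ℓ
      ℓ~p = proj₂ (normalised x≡0 ℓ≢𝟎)

  -- As -a₁₁a₀₂² ≠ 0, scaling achieves a₁₁ = 1; then a₀₂ is any nonzero element, while a₁₂ and a₂₂
  -- are free.
  size-𝓗₃ : HasSize (Through 𝓗₃) ((q ∸ 1) ℕ.* (q ℕ.* q))
  size-𝓗₃ = HasSize-via (Through 𝓗₃)
    (↔-sym *↔× ↔-∘ (NonZero↔ ×-↔ (↔-sym *↔× ↔-∘ (enumeration ×-↔ enumeration)))) conic
    (λ {u} {v} → conic-injective u v) conic-surjective
    where
    discriminant-through : ∀ u v s t → discriminant (0# ∷ 0# ∷ u ∷ v ∷ s ∷ t ∷ []) ≡ - (v * (u * u))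
    discriminant-through u v s t = prove (u ∷ v ∷ s ∷ t ∷ [])
      (P.discriminant (R.0# ∷ R.0# ∷ 𝕧 4 0)) (R.- (𝕩 1 R.* (𝕩 0 R.* 𝕩 0))) refl
    coefficients : NonZero × Carrier × Carrier → QuadraticForm
    coefficients ((u , _) , s , t) = 0# ∷ 0# ∷ u ∷ 1# ∷ s ∷ t ∷ []
    conic : NonZero × Carrier × Carrier → Setoid.Carrier (Through 𝓗₃)
    conic x@((u , u≢0) , s , t) = (coefficients x , λ eq → 1≢0 (cong (λ a → lookup a 3F) eq))
      , Contains-representative⁺ refl refl
      , λ eq → *-nonzero 1≢0 (*-nonzero (toWitnessFalse u≢0) (toWitnessFalse u≢0))
          (-x≡0⇒x≡0 (trans (sym (discriminant-through u 1# s t)) eq))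
    conic-injective : ∀ x y → Proportional (coefficients x) (coefficients y) → x ≡ y
    conic-injective ((u , _) , s , t) ((u′ , _) , s′ , t′) (c , _ , eq) =
      cong₂ _,_ (NonZero-≡ (entry 2F)) (cong₂ _,_ (entry 4F) (entry 5F))
      where
      c≡1 : c ≡ 1#
      c≡1 = trans (sym (*-identityʳ c)) (sym (cong (λ a → lookup a 3F) eq))
      entry : ∀ i → lookup (0# ∷ 0# ∷ u ∷ 1# ∷ s ∷ t ∷ []) i ≡
                    lookup (0# ∷ 0# ∷ u′ ∷ 1# ∷ s′ ∷ t′ ∷ []) i
      entry i = cong (λ a → lookup a i)
        (sym (trans eq (trans (cong (λ d → d · (0# ∷ 0# ∷ u ∷ 1# ∷ s ∷ t ∷ [])) c≡1) (1· _))))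
    conic-surjective : ∀ (a : Setoid.Carrier (Through 𝓗₃)) →
                       ∃ λ x → Proportional (coefficients x) (proj₁ (proj₁ a))
    conic-surjective ((a₀₀ ∷ a₀₁ ∷ u ∷ v ∷ s ∷ t ∷ [] , _) , a⊇ , disc≢0) =
      (nonZero (*-nonzero v⁻¹≢0 u≢0) , v⁻¹ * s , v⁻¹ * t) , v , v≢0 ,
      cong₂ _∷_ (trans a₀₀≡0 (sym (zeroʳ v))) (cong₂ _∷_ (trans a₀₁≡0 (sym (zeroʳ v)))
        (cong₂ _∷_ (sym (cancel-inverse vv⁻¹≡1 u)) (cong₂ _∷_ (sym (*-identityʳ v))
          (cong₂ _∷_ (sym (cancel-inverse vv⁻¹≡1 s)) (cong (_∷ []) (sym (cancel-inverse vv⁻¹≡1 t)))))))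
      where
      a₀₀≡0 : a₀₀ ≡ 0#
      a₀₀≡0 = proj₁ (Contains-representative⁻ a⊇)
      a₀₁≡0 : a₀₁ ≡ 0#
      a₀₁≡0 = proj₂ (Contains-representative⁻ a⊇)
      vuu≢0 : v * (u * u) ≢ 0#
      vuu≢0 eq = disc≢0 (trans (cong₂ (λ x y → discriminant (x ∷ y ∷ u ∷ v ∷ s ∷ t ∷ [])) a₀₀≡0 a₀₁≡0)
        (trans (discriminant-through u v s t) (trans (cong -_ eq) -0#≈0#)))
      v≢0 : v ≢ 0#
      v≢0 v≡0 = vuu≢0 (trans (cong (_* (u * u)) v≡0) (zeroˡ _))
      u≢0 : u ≢ 0#
      u≢0 u≡0 = vuu≢0 (trans (cong (λ w → v * (w * u)) u≡0) (trans (cong (v *_) (zeroˡ u)) (zeroʳ v)))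
      v⁻¹ : Carrier
      v⁻¹ = proj₁ (inverse v v≢0)
      vv⁻¹≡1 : v * v⁻¹ ≡ 1#
      vv⁻¹≡1 = proj₂ (inverse v v≢0)
      v⁻¹≢0 : v⁻¹ ≢ 0#
      v⁻¹≢0 = inverse-nonzero vv⁻¹≡1

  LinePair : Set
  LinePair = Σ (Direction × Direction) (False ∘ λ (p , r) → p ≟ᴰ r)

  LinePair↔ : LinePair ↔ Fin ((q ℕ.+ 1) ℕ.* (q ℕ.+ 1) ∸ (q ℕ.+ 1))
  LinePair↔ = complement-size (λ (p , r) → p ≟ᴰ r)
    (↔-sym *↔× ↔-∘ (Direction↔ ×-↔ Direction↔)) Direction↔
    (λ p → p , p) ,-injectiveˡ (λ _ → refl) (λ { {p , .p} refl → p , refl })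

  swapᴸ : LinePair → LinePair
  swapᴸ ((p , r) , p≢r) = (r , p) , fromWitnessFalse (λ r≡p → toWitnessFalse p≢r (sym r≡p))

  LinePair-≡ : {u v : LinePair} → proj₁ u ≡ proj₁ v → u ≡ v
  LinePair-≡ = False-Σ-≡ (λ (p , r) → p ≟ᴰ r)

  module UnorderedPairs = Involution LinePair↔ swapᴸ (λ _ → LinePair-≡ refl)
    (λ ((p , r) , p≢r) eq → toWitnessFalse p≢r (sym (,-injectiveˡ (cong proj₁ eq))))

  module RealLinePairs where
    open UnorderedPairs
    -- The two families are disjoint up to scalars because a₀₂ is 1 on the first and 0 on the
    -- second; the second consists of the pairs of lines meeting in (1, 0, 0).
    Parameter : Set
    Parameter = (Carrier × Carrier) ⊎ Representative
    e₂ : LinearForm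
    e₂ = 0# ∷ 0# ∷ 1# ∷ []
    pair-form : LinePair → QuadraticForm
    pair-form ((p , r) , _) = linear p ⊛ linear r
    pair-form-swap : ∀ u → pair-form (swapᴸ u) ≡ pair-form u
    pair-form-swap ((p , r) , _) = ⊛-comm (linear r) (linear p)
    coefficients : Parameter → QuadraticForm
    coefficients (inj₁ (s , t)) = e₂ ⊛ (1# ∷ s ∷ t ∷ [])
    coefficients (inj₂ u)       = pair-form (proj₁ u)
    a₀₂ : QuadraticForm → Carrier
    a₀₂ a = lookup a 2F
    a₀₂-inj₁ : ∀ s t → a₀₂ (e₂ ⊛ (1# ∷ s ∷ t ∷ [])) ≡ 1#
    a₀₂-inj₁ s t = prove (t ∷ []) (R.0# R.* 𝕩 0 R.+ R.1# R.* R.1#) R.1# refl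
    a₁₂-inj₁ : ∀ s t → lookup (e₂ ⊛ (1# ∷ s ∷ t ∷ [])) 4F ≡ s
    a₁₂-inj₁ s t = prove (s ∷ t ∷ []) (R.0# R.* 𝕩 1 R.+ R.1# R.* 𝕩 0) (𝕩 0) refl
    a₀₂-linear : ∀ p r → a₀₂ (linear p ⊛ linear r) ≡ 0#
    a₀₂-linear (inj₁ s) (inj₁ t) = prove (s ∷ t ∷ []) (R.0# R.* 𝕩 1 R.+ 𝕩 0 R.* R.0#) R.0# refl
    a₀₂-linear (inj₁ s) (inj₂ _) = prove (s ∷ []) (R.0# R.* R.1# R.+ 𝕩 0 R.* R.0#) R.0# refl
    a₀₂-linear (inj₂ _) (inj₁ t) = prove (t ∷ []) (R.0# R.* 𝕩 0 R.+ R.1# R.* R.0#) R.0# refl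
    a₀₂-linear (inj₂ _) (inj₂ _) = prove [] (R.0# R.* R.1# R.+ R.1# R.* R.0#) R.0# refl
    coefficients≢𝟎 : ∀ x → coefficients x ≢ 𝟎
    coefficients≢𝟎 (inj₁ (s , t)) eq = 1≢0 (trans (sym (a₀₂-inj₁ s t)) (cong a₀₂ eq))
    coefficients≢𝟎 (inj₂ (((p , r) , _) , _)) = linear⊛linear≢𝟎 p r
    coefficients-Contains : ∀ x → Contains (coefficients x) o₆-representative
    coefficients-Contains (inj₁ (s , t)) = Contains-representative⁺ (zeroˡ 1#)
      (prove (s ∷ []) (R.0# R.* 𝕩 0 R.+ R.0# R.* R.1#) R.0# refl)
    coefficients-Contains (inj₂ (((p , r) , _) , _)) = linear⊛linear-Contains p r
    coefficients-𝓗₂,ᵣ : ∀ x → 𝓗₂,ᵣ (coefficients x)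
    coefficients-𝓗₂,ᵣ (inj₁ (s , t)) =
      e₂ , (1# ∷ s ∷ t ∷ []) , (λ (c , _ , eq) → 1≢0 (trans (cong Vec.head eq) (zeroʳ c))) , refl
    coefficients-𝓗₂,ᵣ (inj₂ (((p , r) , p≢r) , _)) =
      linear p , linear r , ≁-linear (toWitnessFalse p≢r) , refl
    lines : Parameter → Setoid.Carrier (Through 𝓗₂,ᵣ)
    lines x = (coefficients x , coefficients≢𝟎 x) , coefficients-Contains x , coefficients-𝓗₂,ᵣ x
    lines-injective : ∀ x y → Proportional (coefficients x) (coefficients y) → x ≡ y
    lines-injective (inj₁ (s , t)) (inj₁ (s′ , t′)) (c , _ , eq) = cong inj₁ (cong₂ _,_
      (trans (sym (a₁₂-inj₁ s t)) (trans (cong (λ a → lookup a 4F) (sym eq′)) (a₁₂-inj₁ s′ t′)))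
      (trans (sym (*-identityˡ t)) (trans (cong (λ a → lookup a 5F) (sym eq′)) (*-identityˡ t′))))
      where
      -- Comparing a₀₂, which is 1 in both normal forms, fixes the scalar.
      c≡1 : c ≡ 1#
      c≡1 = trans (sym (*-identityʳ c)) (trans (cong (c *_) (sym (a₀₂-inj₁ s t)))
        (trans (sym (cong a₀₂ eq)) (a₀₂-inj₁ s′ t′)))
      eq′ : e₂ ⊛ (1# ∷ s′ ∷ t′ ∷ []) ≡ e₂ ⊛ (1# ∷ s ∷ t ∷ [])
      eq′ = trans eq (trans (cong (_· (e₂ ⊛ (1# ∷ s ∷ t ∷ []))) c≡1) (1· _))
    lines-injective (inj₁ (s , t)) (inj₂ (((p , r) , _) , _)) (c , c≢0 , eq) = contradiction
      (trans (sym (*-identityʳ c)) (trans (cong (c *_) (sym (a₀₂-inj₁ s t)))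
        (trans (sym (cong a₀₂ eq)) (a₀₂-linear p r)))) c≢0
    lines-injective (inj₂ (((p , r) , _) , _)) (inj₁ (s , t)) (c , _ , eq) = contradiction
      (trans (sym (a₀₂-inj₁ s t)) (trans (cong a₀₂ eq)
        (trans (a₀₂-· (linear p ⊛ linear r)) (trans (cong (c *_) (a₀₂-linear p r)) (zeroʳ c))))) 1≢0
      where
      a₀₂-· : ∀ a → a₀₂ (c · a) ≡ c * a₀₂ a
      a₀₂-· a = lookup-map 2F (c *_) a
    lines-injective (inj₂ u@(((p , r) , _) , _)) (inj₂ v@(((p′ , r′) , _) , _)) prop =
      go (unique-factorisation p r p′ r′ prop)
      where
      go : (p ≡ p′ × r ≡ r′) ⊎ (p ≡ r′ × r ≡ p′) → inj₂ u ≡ inj₂ v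
      go (inj₁ (p≡p′ , r≡r′)) = cong inj₂ (distinct-representatives {u} {v}
        (inj₁ (LinePair-≡ (cong₂ _,_ p≡p′ r≡r′))))
      go (inj₂ (p≡r′ , r≡p′)) = cong inj₂ (distinct-representatives {u} {v}
        (inj₂ (LinePair-≡ (cong₂ _,_ p≡r′ r≡p′))))
    -- Since a₀₀ = xx′ = 0, one factor lacks X₀, here ℓ. If m lacks it too, the form is binary;
    -- otherwise a₀₁ = yx′ = 0 gives y = 0, so ℓ is a multiple of X₂.
    lines-surjective₀ : ∀ {x y z x′ y′ z′} → let ℓ = x ∷ y ∷ z ∷ [] ; m = x′ ∷ y′ ∷ z′ ∷ [] in
      x ≡ 0# → ℓ ≢ 𝟎 → m ≢ 𝟎 → ¬ Proportional ℓ m → Contains (ℓ ⊛ m) o₆-representative →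
      ∃ λ u → Proportional (coefficients u) (ℓ ⊛ m)
    lines-surjective₀ {x} {y} {z} {x′} {y′} {z′} x≡0 ℓ≢𝟎 m≢𝟎 ℓ≁m a⊇ = go (x′ ≟ 0#)
      where
      ℓ m : LinearForm
      ℓ = x ∷ y ∷ z ∷ []
      m = x′ ∷ y′ ∷ z′ ∷ []
      go : Dec (x′ ≡ 0#) → ∃ λ u → Proportional (coefficients u) (ℓ ⊛ m)
      go (yes x′≡0) = pair (normalised x≡0 ℓ≢𝟎) (normalised x′≡0 m≢𝟎)
        where
        pair : (∃ λ p → Proportional (linear p) ℓ) → (∃ λ r → Proportional (linear r) m) →
               ∃ λ u → Proportional (coefficients u) (ℓ ⊛ m)
        pair (p , p~ℓ) (r , r~m) = choose (representative pr)
          where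
          pr : LinePair
          pr = (p , r) , fromWitnessFalse (λ p≡r →
            ℓ≁m (Proportional-trans (Proportional-sym p~ℓ)
              (subst (λ s → Proportional (linear s) m) (sym p≡r) r~m)))
          choose : (∃ λ s → pr ≡ proj₁ s ⊎ pr ≡ swapᴸ (proj₁ s)) →
                   ∃ λ u → Proportional (coefficients u) (ℓ ⊛ m)
          choose (s , inj₁ eq) = inj₂ s ,
            subst (λ a → Proportional a (ℓ ⊛ m)) (cong pair-form eq) (⊛-proportional p~ℓ r~m)
          choose (s , inj₂ eq) = inj₂ s ,
            subst (λ a → Proportional a (ℓ ⊛ m)) (trans (cong pair-form eq) (pair-form-swap (proj₁ s)))
              (⊛-proportional p~ℓ r~m)
      go (no x′≢0) = inj₁ (x′⁻¹ * y′ , x′⁻¹ * z′) , ⊛-proportional e₂~ℓ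
          (x′ , x′≢0 , cong₂ _∷_ (sym (*-identityʳ x′)) (cong₂ _∷_ (sym (cancel-inverse x′x′⁻¹≡1 y′))
            (cong (_∷ []) (sym (cancel-inverse x′x′⁻¹≡1 z′)))))
        where
        x′⁻¹ : Carrier
        x′⁻¹ = proj₁ (inverse x′ x′≢0)
        x′x′⁻¹≡1 : x′ * x′⁻¹ ≡ 1#
        x′x′⁻¹≡1 = proj₂ (inverse x′ x′≢0)
        y≡0 : y ≡ 0#
        y≡0 with zero-product (trans (sym (+-identityˡ _))
                  (trans (cong (_+ y * x′) (sym (trans (cong (_* y′) x≡0) (zeroˡ y′))))
                  (proj₂ (Contains-representative⁻ a⊇))))
        ... | inj₁ eq = eq
        ... | inj₂ eq = contradiction eq x′≢0
        z≢0 : z ≢ 0#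
        z≢0 z≡0 = ℓ≢𝟎 (cong₂ _∷_ x≡0 (cong₂ _∷_ y≡0 (cong (_∷ []) z≡0)))
        e₂~ℓ : Proportional e₂ ℓ
        e₂~ℓ = z , z≢0 , cong₂ _∷_ (trans x≡0 (sym (zeroʳ z)))
          (cong₂ _∷_ (trans y≡0 (sym (zeroʳ z))) (cong (_∷ []) (sym (*-identityʳ z))))
    lines-surjective : ∀ (a : Setoid.Carrier (Through 𝓗₂,ᵣ)) →
                       ∃ λ u → Proportional (coefficients u) (proj₁ (proj₁ a))
    lines-surjective ((_ , a≢𝟎) , a⊇ , ℓ@(x ∷ y ∷ z ∷ []) , m@(x′ ∷ y′ ∷ z′ ∷ []) , ℓ≁m , refl) =
      go (zero-product (proj₁ (Contains-representative⁻ a⊇)))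
      where
      ℓ≢𝟎 : ℓ ≢ 𝟎
      ℓ≢𝟎 eq = a≢𝟎 (trans (cong (_⊛ m) eq) (𝟎⊛ m))
      m≢𝟎 : m ≢ 𝟎
      m≢𝟎 eq = a≢𝟎 (trans (⊛-comm ℓ m) (trans (cong (_⊛ ℓ) eq) (𝟎⊛ ℓ)))
      go : x ≡ 0# ⊎ x′ ≡ 0# → ∃ λ u → Proportional (coefficients u) (ℓ ⊛ m)
      go (inj₁ x≡0)  = lines-surjective₀ x≡0 ℓ≢𝟎 m≢𝟎 ℓ≁m a⊇
      go (inj₂ x′≡0) = subst (λ a → ∃ λ u → Proportional (coefficients u) a) (⊛-comm m ℓ)
        (lines-surjective₀ x′≡0 m≢𝟎 ℓ≢𝟎 (λ p → ℓ≁m (Proportional-sym p))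
          (subst (λ a → Contains a o₆-representative) (⊛-comm ℓ m) a⊇))

  size-𝓗₂,ᵣ : HasSize (Through 𝓗₂,ᵣ) (q ℕ.* q ℕ.+ ((q ℕ.+ 1) ℕ.* (q ℕ.+ 1) ∸ (q ℕ.+ 1)) / 2)
  size-𝓗₂,ᵣ = HasSize-via (Through 𝓗₂,ᵣ)
    (↔-sym +↔⊎ ↔-∘ ((↔-sym *↔× ↔-∘ (enumeration ×-↔ enumeration)) ⊎-↔ UnorderedPairs.Representative↔))
    lines (λ {u} {v} → lines-injective u v) lines-surjective
    where open RealLinePairs

  map-ι-injective : ∀ {m} {v w : Vec Carrier m} → map ι v ≡ map ι w → v ≡ w
  map-ι-injective {v = []}    {[]}    _  = refl
  map-ι-injective {v = x ∷ v} {y ∷ w} eq =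
    cong₂ _∷_ (ι-injective (cong Vec.head eq)) (map-ι-injective (cong Vec.tail eq))

  map-ι-· : ∀ {m} c (v : Vec Carrier m) → map ι (c · v) ≡ ι c PE.· map ι v
  map-ι-· c []      = refl
  map-ι-· c (x ∷ v) = cong₂ _∷_ (*-homo c x) (map-ι-· c v)

  -- `E` without the image of `F`, as a decidable test: by `conjugate-ι` and `conjugate-fixed` that
  -- image is the fixed field of conjugation.
  Imaginary : Set
  Imaginary = Σ E.Carrier (False ∘ λ β → conjugate β E.≟ β)

  Imaginary↔ : Imaginary ↔ Fin (q ℕ.^ 2 ∸ q)
  Imaginary↔ = complement-size (λ β → conjugate β E.≟ β) E.enumeration enumeration ι
    ι-injective conjugate-ι conjugate-fixed

  Imaginary-≡ : {u v : Imaginary} → proj₁ u ≡ proj₁ v → u ≡ v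
  Imaginary-≡ = False-Σ-≡ (λ β → conjugate β E.≟ β)

  conjugateᴵ : Imaginary → Imaginary
  conjugateᴵ (β , β̄≢β) = conjugate β , fromWitnessFalse (λ eq →
    toWitnessFalse β̄≢β (trans (sym eq) (conjugate-involutive β)))

  module ConjugatePairs = Involution Imaginary↔ conjugateᴵ
    (λ (β , _) → Imaginary-≡ (conjugate-involutive β))
    (λ (β , β̄≢β) eq → toWitnessFalse β̄≢β (cong proj₁ eq))

  module ImaginaryLinePairs where
    open ConjugatePairs

    conjugateᴰ : BE.Direction → BE.Direction
    conjugateᴰ (inj₁ β) = inj₁ (conjugate β)
    conjugateᴰ (inj₂ _) = inj₂ tt

    conjugate-linear : ∀ p → map conjugate (BE.linear p) ≡ BE.linear (conjugateᴰ p)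
    conjugate-linear (inj₁ β) = cong₂ (λ x y → x ∷ y ∷ conjugate β ∷ []) conjugate-0 conjugate-1
    conjugate-linear (inj₂ _) = cong₂ (λ x y → x ∷ x ∷ y ∷ []) conjugate-0 conjugate-1

    conjugate-· : ∀ d (ℓ : PE.LinearForm) → map conjugate (d PE.· ℓ) ≡ conjugate d PE.· map conjugate ℓ
    conjugate-· d (x ∷ y ∷ z ∷ []) =
      cong₂ _∷_ (conjugate-* d x) (cong₂ _∷_ (conjugate-* d y) (cong (_∷ []) (conjugate-* d z)))

    -- The product (X₁ + βX₂)(X₁ + β̄X₂), still over `E`.
    norm-form : E.Carrier → PE.QuadraticForm
    norm-form β = BE.linear (inj₁ β) PE.⊛ BE.linear (inj₁ (conjugate β))

    norm-form-conjugate : ∀ β → norm-form (conjugate β) ≡ norm-form β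
    norm-form-conjugate β = trans
      (cong (λ γ → BE.linear (inj₁ (conjugate β)) PE.⊛ BE.linear (inj₁ γ)) (conjugate-involutive β))
      (BE.⊛-comm (BE.linear (inj₁ (conjugate β))) (BE.linear (inj₁ β)))

    norm∈F : ∀ β → ∃ λ x → ι x ≡ β E.* conjugate β
    norm∈F β = conjugate-fixed (trans (conjugate-* β (conjugate β))
      (trans (cong (conjugate β E.*_) (conjugate-involutive β)) (E.*-comm (conjugate β) β)))

    trace∈F : ∀ β → ∃ λ x → ι x ≡ β E.+ conjugate β
    trace∈F β = conjugate-fixed (trans (conjugate-+ β (conjugate β))
      (trans (cong (conjugate β E.+_) (conjugate-involutive β)) (E.+-comm (conjugate β) β)))

    -- The descent of `norm-form` to `F`: X₁² + Tr(β)X₁X₂ + N(β)X₂².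
    coefficients : E.Carrier → QuadraticForm
    coefficients β = 0# ∷ 0# ∷ 0# ∷ 1# ∷ proj₁ (trace∈F β) ∷ proj₁ (norm∈F β) ∷ []

    map-ι-coefficients : ∀ β → map ι (coefficients β) ≡ norm-form β
    map-ι-coefficients β = trans
      (cong₂ _∷_ 0#-homo (cong₂ _∷_ 0#-homo (cong₂ _∷_ 0#-homo (cong₂ _∷_ 1#-homo
        (cong₂ _∷_ (proj₂ (trace∈F β)) (cong (_∷ []) (proj₂ (norm∈F β))))))))
      (sym (BE.linear⊛linear β (conjugate β)))

    -- Trace and norm enter as chosen preimages under `ι`, so the comparison takes place over `E`
    -- and injectivity brings it back.
    coefficients-conjugate : ∀ β → coefficients (conjugate β) ≡ coefficients β
    coefficients-conjugate β = map-ι-injective (trans (map-ι-coefficients (conjugate β))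
      (trans (norm-form-conjugate β) (sym (map-ι-coefficients β))))

    coefficients-𝓗₂,ᵢ : ∀ β → conjugate β ≢ β → 𝓗₂,ᵢ (coefficients β)
    coefficients-𝓗₂,ᵢ β β̄≢β = 1# , BE.linear (inj₁ β) ,
      (λ p → BE.≁-linear (λ eq → β̄≢β (sym (inj₁-injective eq)))
        (subst (PE.Proportional (BE.linear (inj₁ β))) (conjugate-linear (inj₁ β)) p)) ,
      (begin
        map ι (coefficients β)   ≡⟨ map-ι-coefficients β ⟩
        norm-form β              ≡⟨ cong (f PE.⊛_) (conjugate-linear (inj₁ β)) ⟨
        f PE.⊛ map conjugate f   ≡⟨ BE.1· (f PE.⊛ map conjugate f) ⟨
        E.1# PE.· (f PE.⊛ map conjugate f)  ≡⟨ cong (PE._· (f PE.⊛ map conjugate f)) 1#-homo ⟨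
        ι 1# PE.· (f PE.⊛ map conjugate f)  ∎)
      where
      f : PE.LinearForm
      f = BE.linear (inj₁ β)

    form : Representative → Setoid.Carrier (Through 𝓗₂,ᵢ)
    form ((β , β̄≢β) , _) =
      (coefficients β , λ eq → 1≢0 (cong (λ a → lookup a 3F) eq)) ,
      Contains-representative⁺ refl refl , coefficients-𝓗₂,ᵢ β (toWitnessFalse β̄≢β)

    -- Over `E` the form splits, and unique factorisation recovers the pair {β, β̄}.
    form-injective : ∀ u v →
      Proportional (coefficients (proj₁ (proj₁ u))) (coefficients (proj₁ (proj₁ v))) → u ≡ v
    form-injective u@((β , _) , _) v@((γ , _) , _) (c , c≢0 , eq) =
      go (BE.unique-factorisation (inj₁ β) (inj₁ (conjugate β)) (inj₁ γ) (inj₁ (conjugate γ))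
        (ι c , ιc≢0 , eqᴱ))
      where
      ιc≢0 : ι c ≢ E.0#
      ιc≢0 ιc≡0 = c≢0 (ι-injective (trans ιc≡0 (sym 0#-homo)))
      eqᴱ : norm-form γ ≡ ι c PE.· norm-form β
      eqᴱ = begin
        norm-form γ                    ≡⟨ map-ι-coefficients γ ⟨
        map ι (coefficients γ)         ≡⟨ cong (map ι) eq ⟩
        map ι (c · coefficients β)     ≡⟨ map-ι-· c (coefficients β) ⟩
        ι c PE.· map ι (coefficients β)  ≡⟨ cong (ι c PE.·_) (map-ι-coefficients β) ⟩
        ι c PE.· norm-form β           ∎
      go : (inj₁ β ≡ inj₁ γ × inj₁ (conjugate β) ≡ inj₁ (conjugate γ))
           ⊎ (inj₁ β ≡ inj₁ (conjugate γ) × inj₁ (conjugate β) ≡ inj₁ γ) → u ≡ v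
      go (inj₁ (β≡γ , _)) = distinct-representatives {u} {v} (inj₁ (Imaginary-≡ (inj₁-injective β≡γ)))
      go (inj₂ (β≡γ̄ , _)) = distinct-representatives {u} {v} (inj₂ (Imaginary-≡ (inj₁-injective β≡γ̄)))

    form-surjective : ∀ (a : Setoid.Carrier (Through 𝓗₂,ᵢ)) →
                      ∃ λ (u : Representative) → Proportional (coefficients (proj₁ (proj₁ u))) (proj₁ (proj₁ a))
    form-surjective ((a@vec₆ , a≢𝟎) , a⊇ , c , ℓ@(x ∷ y ∷ z ∷ []) , ℓ≁ℓ̄ , eq) =
      go (BE.normalised x≡0 ℓ≢𝟎)
      where
      map-ι-a≢𝟎 : map ι a ≢ PE.𝟎
      map-ι-a≢𝟎 ιa≡𝟎 = a≢𝟎 (map-ι-injective (trans ιa≡𝟎 (cong (replicate 6) (sym 0#-homo))))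
      ℓ≢𝟎 : ℓ ≢ PE.𝟎
      ℓ≢𝟎 ℓ≡𝟎 = map-ι-a≢𝟎 (trans eq (trans (cong (ι c PE.·_)
        (trans (cong (PE._⊛ map conjugate ℓ) ℓ≡𝟎) (BE.𝟎⊛ (map conjugate ℓ)))) (BE.·𝟎 (ι c))))
      c≢0 : c ≢ 0#
      c≢0 c≡0 = map-ι-a≢𝟎 (trans eq (trans
        (cong (PE._· (ℓ PE.⊛ map conjugate ℓ)) (trans (cong ι c≡0) 0#-homo))
        (BE.0· (ℓ PE.⊛ map conjugate ℓ))))
      -- The condition a₀₀ = 0 reads c·x·x̄ = 0 and removes X₀ from ℓ.
      norm-x≡0 : ι c E.* (x E.* conjugate x) ≡ E.0#
      norm-x≡0 = trans (sym (cong Vec.head eq)) (trans (cong ι (proj₁ (Contains-representative⁻ a⊇))) 0#-homo)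
      conjugate-≡0 : ∀ {x} → conjugate x ≡ E.0# → x ≡ E.0#
      conjugate-≡0 {x} x̄≡0 = trans (sym (conjugate-involutive x)) (trans (cong conjugate x̄≡0) conjugate-0)
      x≡0 : x ≡ E.0#
      x≡0 with E.zero-product norm-x≡0
      ... | inj₁ ιc≡0 = contradiction (ι-injective (trans ιc≡0 (sym 0#-homo))) c≢0
      ... | inj₂ xx̄≡0 with E.zero-product xx̄≡0
      ...   | inj₁ x≡0 = x≡0
      ...   | inj₂ x̄≡0 = conjugate-≡0 x̄≡0
      -- A direction fixed by conjugation would make ℓ proportional to its conjugate. This excludes
      -- both X₂ and every β in `F`.
      ℓ~ℓ̄ : ∀ p → conjugateᴰ p ≡ p → PE.Proportional (BE.linear p) ℓ → ⊥
      ℓ~ℓ̄ p p̄≡p (d , d≢0 , ℓ≡) = ℓ≁ℓ̄ (BE.Proportional-trans (BE.Proportional-sym (d , d≢0 , ℓ≡))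
        (conjugate d , (λ d̄≡0 → d≢0 (conjugate-≡0 d̄≡0)) , ℓ̄≡ p d ℓ≡ p̄≡p))
        where
        ℓ̄≡ : ∀ p d → ℓ ≡ d PE.· BE.linear p → conjugateᴰ p ≡ p →
             map conjugate ℓ ≡ conjugate d PE.· BE.linear p
        ℓ̄≡ p d ℓ≡ p̄≡p = trans (cong (map conjugate) ℓ≡) (trans (conjugate-· d (BE.linear p))
          (cong (conjugate d PE.·_) (trans (conjugate-linear p) (cong BE.linear p̄≡p))))
      go : (∃ λ p → PE.Proportional (BE.linear p) ℓ) →
           ∃ λ u → Proportional (coefficients (proj₁ (proj₁ u))) a
      go (inj₂ _ , ℓ~p) = contradiction ℓ~p (ℓ~ℓ̄ (inj₂ tt) refl)
      go (inj₁ β , d , d≢0 , ℓ≡) = choose (representative b)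
        where
        b : Imaginary
        b = β , fromWitnessFalse (λ β̄≡β → ℓ~ℓ̄ (inj₁ β) (cong inj₁ β̄≡β) (d , d≢0 , ℓ≡))
        -- The scalar d in ℓ = d(X₁ + βX₂) lies only in `E`, but the product with the conjugate
        -- involves just its norm dd̄, which comes from `F`.
        e : Carrier
        e = proj₁ (norm∈F d)
        ιe≡ : ι e ≡ d E.* conjugate d
        ιe≡ = proj₂ (norm∈F d)
        e≢0 : e ≢ 0#
        e≢0 e≡0 = E.*-nonzero d≢0 (λ d̄≡0 → d≢0 (conjugate-≡0 d̄≡0))
          (trans (sym ιe≡) (trans (cong ι e≡0) 0#-homo))
        a≡ : a ≡ (c * e) · coefficients β
        a≡ = map-ι-injective (begin
          map ι a
            ≡⟨ eq ⟩
          ι c PE.· (ℓ PE.⊛ map conjugate ℓ)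
            ≡⟨ cong₂ (λ l m → ι c PE.· (l PE.⊛ m)) ℓ≡ ℓ̄≡ ⟩
          ι c PE.· ((d PE.· f) PE.⊛ (conjugate d PE.· f̄))
            ≡⟨ cong (ι c PE.·_) (BE.·-⊛-· d (conjugate d) f f̄) ⟩
          ι c PE.· (d E.* conjugate d) PE.· norm-form β
            ≡⟨ cong (λ z → ι c PE.· z PE.· norm-form β) ιe≡ ⟨
          ι c PE.· ι e PE.· norm-form β
            ≡⟨ BE.·-· (ι c) (ι e) (norm-form β) ⟩
          (ι c E.* ι e) PE.· norm-form β
            ≡⟨ cong₂ PE._·_ (*-homo c e) (map-ι-coefficients β) ⟨
          ι (c * e) PE.· map ι (coefficients β)
            ≡⟨ map-ι-· (c * e) (coefficients β) ⟨
          map ι ((c * e) · coefficients β)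
            ∎)
          where
          f f̄ : PE.LinearForm
          f = BE.linear (inj₁ β)
          f̄ = BE.linear (inj₁ (conjugate β))
          ℓ̄≡ : map conjugate ℓ ≡ conjugate d PE.· f̄
          ℓ̄≡ = trans (cong (map conjugate) ℓ≡) (trans (conjugate-· d f)
            (cong (conjugate d PE.·_) (conjugate-linear (inj₁ β))))
        prop : Proportional (coefficients β) a
        prop = c * e , *-nonzero c≢0 e≢0 , a≡
        choose : (∃ λ u → b ≡ proj₁ u ⊎ b ≡ conjugateᴵ (proj₁ u)) →
                 ∃ λ u → Proportional (coefficients (proj₁ (proj₁ u))) a
        choose (u , inj₁ b≡u) = u , subst (λ f → Proportional f a) (cong (coefficients ∘ proj₁) b≡u) prop
        choose (u , inj₂ b≡ū) = u , subst (λ f → Proportional f a)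
          (trans (cong (coefficients ∘ proj₁) b≡ū) (coefficients-conjugate (proj₁ (proj₁ u)))) prop

  size-𝓗₂,ᵢ : HasSize (Through 𝓗₂,ᵢ) ((q ℕ.^ 2 ∸ q) / 2)
  size-𝓗₂,ᵢ = HasSize-via (Through 𝓗₂,ᵢ) ConjugatePairs.Representative↔ form
    (λ {u} {v} → form-injective u v) form-surjective
    where open ImaginaryLinePairs

-- Arithmetic of the counts.

open import Data.Nat.Base using (ℕ; _+_; _*_; _∸_; _^_)
open import Data.Nat.DivMod using (_/_)
open import Data.Vec.Base using (Vec; []; _∷_)

-- The truncated difference is q(q + 1). To join it under the floor division, q² is written as
-- (q²·2)/2, whose numerator is divisible by 2.
unordered-pairs-count : ∀ q → q * q + ((q + 1) * (q + 1) ∸ (q + 1)) / 2 ≡ (3 * q ^ 2 + q) / 2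
unordered-pairs-count q = begin
  q * q + ((q + 1) * (q + 1) ∸ (q + 1)) / 2  ≡⟨ cong (λ k → q * q + (k ∸ (q + 1)) / 2) (square q) ⟩
  q * q + (q * (q + 1) + (q + 1) ∸ (q + 1)) / 2  ≡⟨ cong (λ k → q * q + k / 2) (m+n∸n≡m (q * (q + 1)) (q + 1)) ⟩
  q * q + (q * (q + 1)) / 2                  ≡⟨ cong (_+ (q * (q + 1)) / 2) (m*n/n≡m (q * q) 2) ⟨
  (q * q * 2) / 2 + (q * (q + 1)) / 2        ≡⟨ +-distrib-/-∣ˡ (q * (q + 1)) (n∣m*n (q * q)) ⟨
  (q * q * 2 + q * (q + 1)) / 2              ≡⟨ cong (_/ 2) (total q) ⟩
  (3 * q ^ 2 + q) / 2                        ∎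
  where
  square : ∀ q → (q + 1) * (q + 1) ≡ q * (q + 1) + (q + 1)
  square = solve-∀
  -- Here q * (q * 1) is the unfolding of `q ^ 2`.
  total : ∀ q → q * q * 2 + q * (q + 1) ≡ 3 * (q * (q * 1)) + q
  total = solve-∀

nonsingular-count : ∀ q → (q ∸ 1) * (q * q) ≡ q ^ 3 ∸ q ^ 2
nonsingular-count q = trans (*-distribʳ-∸ (q * q) q 1) (cong₂ _∸_ (cube q) (square q))
  where
  cube : ∀ q → q * (q * q) ≡ q * (q * (q * 1))
  cube = solve-∀
  square : ∀ q → 1 * (q * q) ≡ q * (q * 1)
  square = solve-∀

lemma4p3 : (q : ℕ) → IsPrimePower q →
    (F : FiniteField q) (E∕F : QuadraticExtension F) →
    (L : Projective.Line F 5) → Projective.o₆ F L →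
    HyperplaneOrbits.OD₄[_]≡ E∕F L
    ( q + 1
    ∷ (3 * q ^ 2 + q) / 2
    ∷ (q ^ 2 ∸ q) / 2
    ∷ q ^ 3 ∸ q ^ 2
    ∷ [] )
lemma4p3 q _ F E∕F L L∈o₆ =
    image 𝓗₁-invariant size-𝓗₁
  , subst (HasSize (HyperplanesThrough L 𝓗₂,ᵣ)) (unordered-pairs-count q) (image 𝓗₂,ᵣ-invariant size-𝓗₂,ᵣ)
  , image 𝓗₂,ᵢ-invariant size-𝓗₂,ᵢ
  , subst (HasSize (HyperplanesThrough L 𝓗₃)) (nonsingular-count q) (image 𝓗₃-invariant size-𝓗₃)
  where
  open HyperplaneOrbits E∕F
  open Transport E∕F
  open RepresentativeSizes E∕F
  image : ∀ {𝓗 n} → Invariant 𝓗 → HasSize (Through 𝓗) n → HasSize (HyperplanesThrough L 𝓗) n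
  image {𝓗} = HasSize-image L L∈o₆ {𝓗}
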